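{- Let $q$ be a power of a prime $p$. For every $n\ge1$, one has in $\mathbb F_q[B,C]$ $$\mathcal U_n(B,C)=\prod_{\substack{d\mid n\\ d>1}}\Lambda_d(B,C)\qquad\text{and}\qquad \mathcal V_n(B,C)=\prod_{\substack{d\mid 2n\\ d\nmid n}}\Lambda_d(B,C),$$ where for $n=1$ the product $\prod_{d\mid n,\,d>1}\Lambda_d(B,C)$ is set to be $1$.
   Context: Let $B,C$ be algebraically independent indeterminates over $\mathbb F_q$. Lucas polynomials: $\mathcal U_0=0$, $\mathcal U_1=1$, $\mathcal U_n=-B\,\mathcal U_{n-1}-C\,\mathcal U_{n-2}$ and $\mathcal V_0=2$, $\mathcal V_1=-B$, $\mathcal V_n=-B\,\mathcal V_{n-1}-C\,\mathcal V_{n-2}$ for $n\ge2$. Lucas atoms: let $\alpha,\beta$ be the two roots of $T^2+BT+C$ in an algebraic closure of $\mathbb F_q(B,C)$. Let $\Phi_n(X)\in\mathbb F_q[X]$ be the $n$-th cyclotomic polynomial over $\mathbb F_q$ (the image of the integral one, also when $p\mid n$), $\varphi$ Euler's totient function, and $\Phi_n^{\mathrm{hom}}(\alpha,\beta)=\beta^{\varphi(n)}\Phi_n(\alpha/\beta)$. Set $\Lambda_1=1$, and for $n\ge2$ the $n$-th Lucas atom $\Lambda_n(B,C)\in\mathbb F_q[B,C]$ is the unique polynomial with $\Lambda_n(B,C)=\Phi_n^{\mathrm{hom}}(\alpha,\beta)$. -}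

module Defs where

open import Algebra.Bundles using (CommutativeRing)
open import Algebra.Morphism.Structures using (IsRingMonomorphism)
import Algebra.Properties.Monoid.Mult as MonoidMult
import Algebra.Properties.Ring as RingProperties
import Algebra.Properties.Semiring.Exp as SemiringExp
open import Data.Bool.Base using (if_then_else_)
open import Data.Fin.Base using (Fin)
open import Data.Integer.Base using (ℤ; +_; -[1+_]; 0ℤ; 1ℤ; -1ℤ)
import Data.Integer.Properties as ℤₚ
open import Data.List.Base
  using (List; []; _∷_; _++_; map; foldr; filter; length; upTo; replicate)
open import Data.List.Relation.Unary.All using (All; all?)
open import Data.Nat.Base using (ℕ; zero; suc; _≤_)
open import Data.Nat.Coprimality using (coprime?)
open import Data.Nat.Divisibility using (_∣?_)
open import Data.Product.Base using (_×_; _,_; proj₁; proj₂; ∃-syntax)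
open import Function.Base using (_∘_)
open import Function.Bundles using (Bijection)
open import Level using (Level; _⊔_) renaming (suc to lsuc)
open import Relation.Binary.Definitions using (Decidable)
open import Relation.Binary.PropositionalEquality as ≡ using ()
open import Relation.Binary.Structures using (IsEquivalence)
open import Relation.Nullary.Decidable using (yes; no; does)

private variable
  c ℓ c′ ℓ′ : Level

-- A polynomial is its list of coefficients, lowest degree first.  Trailing
-- zeros are allowed, so equality compares coefficients.

module Polynomials {c ℓ} (R : CommutativeRing c ℓ) where
  open CommutativeRing R
  open RingProperties ring using (-0#≈0#)

  Poly : Set c
  Poly = List Carrier

  coeff : Poly → ℕ → Carrier
  coeff []      _       = 0#
  coeff (a ∷ f) zero    = a
  coeff (a ∷ f) (suc i) = coeff f i

  -- A record rather than a function type, so that f and g can be inferred.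
  infix 4 _≋_
  record _≋_ (f g : Poly) : Set ℓ where
    constructor mk≋
    field at : ∀ i → coeff f i ≈ coeff g i
  open _≋_ public

  infixl 6 _⊕_
  infixl 7 _⊗_
  infixr 7 _•_
  infix  8 ⊝_

  _⊕_ : Poly → Poly → Poly
  []      ⊕ g       = g
  (a ∷ f) ⊕ []      = a ∷ f
  (a ∷ f) ⊕ (b ∷ g) = a + b ∷ f ⊕ g

  ⊝_ : Poly → Poly
  ⊝_ = map (-_)

  _•_ : Carrier → Poly → Poly
  a • g = map (a *_) g

  _⊗_ : Poly → Poly → Poly
  []      ⊗ g = []
  (a ∷ f) ⊗ g = a • g ⊕ (0# ∷ f ⊗ g)

  const : Carrier → Poly
  const a = a ∷ []

  X : Poly
  X = 0# ∷ 1# ∷ []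

  eval : Poly → Carrier → Carrier
  eval []      x = 0#
  eval (a ∷ f) x = a + x * eval f x

  ≋-isEquivalence : IsEquivalence _≋_
  ≋-isEquivalence = record
    { refl  = mk≋ λ _ → refl
    ; sym   = λ p → mk≋ λ i → sym (at p i)
    ; trans = λ p q → mk≋ λ i → trans (at p i) (at q i)
    }

  private
    open module E = IsEquivalence ≋-isEquivalence
      using () renaming (refl to ≋-refl; sym to ≋-sym; trans to ≋-trans)

  coeff-⊕ : ∀ f g i → coeff (f ⊕ g) i ≈ coeff f i + coeff g i
  coeff-⊕ []      g       i       = sym (+-identityˡ _)
  coeff-⊕ (a ∷ f) []      i       = sym (+-identityʳ _)
  coeff-⊕ (a ∷ f) (b ∷ g) zero    = refl
  coeff-⊕ (a ∷ f) (b ∷ g) (suc i) = coeff-⊕ f g i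

  coeff-⊝ : ∀ f i → coeff (⊝ f) i ≈ - coeff f i
  coeff-⊝ []      i       = sym -0#≈0#
  coeff-⊝ (a ∷ f) zero    = refl
  coeff-⊝ (a ∷ f) (suc i) = coeff-⊝ f i

  coeff-• : ∀ a f i → coeff (a • f) i ≈ a * coeff f i
  coeff-• a []      i       = sym (zeroʳ a)
  coeff-• a (b ∷ f) zero    = refl
  coeff-• a (b ∷ f) (suc i) = coeff-• a f i

  ∷-cong : ∀ {a b f g} → a ≈ b → f ≋ g → a ∷ f ≋ b ∷ g
  ∷-cong p q = mk≋ λ { zero → p ; (suc i) → at q i }

  0∷[] : 0# ∷ [] ≋ []
  0∷[] = mk≋ λ { zero → refl ; (suc i) → refl }

  ⊕-cong : ∀ {f f′ g g′} → f ≋ f′ → g ≋ g′ → f ⊕ g ≋ f′ ⊕ g′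
  ⊕-cong {f} {f′} {g} {g′} p q = mk≋ λ i →
    trans (coeff-⊕ f g i)
      (trans (+-cong (at p i) (at q i)) (sym (coeff-⊕ f′ g′ i)))

  ⊝-cong : ∀ {f g} → f ≋ g → ⊝ f ≋ ⊝ g
  ⊝-cong {f} {g} p = mk≋ λ i →
    trans (coeff-⊝ f i) (trans (-‿cong (at p i)) (sym (coeff-⊝ g i)))

  •-cong : ∀ {a b f g} → a ≈ b → f ≋ g → a • f ≋ b • g
  •-cong {a} {b} {f} {g} p q = mk≋ λ i →
    trans (coeff-• a f i) (trans (*-cong p (at q i)) (sym (coeff-• b g i)))

  ⊕-assoc : ∀ f g h → (f ⊕ g) ⊕ h ≋ f ⊕ (g ⊕ h)
  ⊕-assoc f g h = mk≋ λ i →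
    trans (coeff-⊕ (f ⊕ g) h i)
      (trans (+-congʳ (coeff-⊕ f g i))
        (trans (+-assoc _ _ _)
          (trans (+-congˡ (sym (coeff-⊕ g h i)))
            (sym (coeff-⊕ f (g ⊕ h) i)))))

  ⊕-comm : ∀ f g → f ⊕ g ≋ g ⊕ f
  ⊕-comm f g = mk≋ λ i →
    trans (coeff-⊕ f g i) (trans (+-comm _ _) (sym (coeff-⊕ g f i)))

  ⊕-identityʳ : ∀ f → f ⊕ [] ≋ f
  ⊕-identityʳ f = ⊕-comm f []

  ⊕-inverseʳ : ∀ f → f ⊕ ⊝ f ≋ []
  ⊕-inverseʳ f = mk≋ λ i →
    trans (coeff-⊕ f (⊝ f) i)
      (trans (+-congˡ (coeff-⊝ f i)) (-‿inverseʳ _))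

  ⊕-interchange : ∀ f g h k → (f ⊕ g) ⊕ (h ⊕ k) ≋ (f ⊕ h) ⊕ (g ⊕ k)
  ⊕-interchange f g h k =
    ≋-trans (⊕-assoc f g (h ⊕ k))
      (≋-trans (⊕-cong (≋-refl {f}) inner) (≋-sym (⊕-assoc f h (g ⊕ k))))
    where
    inner : g ⊕ (h ⊕ k) ≋ h ⊕ (g ⊕ k)
    inner = ≋-trans (≋-sym (⊕-assoc g h k))
              (≋-trans (⊕-cong (⊕-comm g h) ≋-refl) (⊕-assoc h g k))

  •-distribˡ-⊕ : ∀ a f g → a • (f ⊕ g) ≋ a • f ⊕ a • g
  •-distribˡ-⊕ a f g = mk≋ λ i →
    trans (coeff-• a (f ⊕ g) i)
      (trans (*-congˡ (coeff-⊕ f g i))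
        (trans (distribˡ a _ _)
          (trans (+-cong (sym (coeff-• a f i)) (sym (coeff-• a g i)))
            (sym (coeff-⊕ (a • f) (a • g) i)))))

  •-distribʳ-+ : ∀ a b f → (a + b) • f ≋ a • f ⊕ b • f
  •-distribʳ-+ a b f = mk≋ λ i →
    trans (coeff-• (a + b) f i)
      (trans (distribʳ _ a b)
        (trans (+-cong (sym (coeff-• a f i)) (sym (coeff-• b f i)))
          (sym (coeff-⊕ (a • f) (b • f) i))))

  •-assoc : ∀ a b f → a • (b • f) ≋ (a * b) • f
  •-assoc a b f = mk≋ λ i →
    trans (coeff-• a (b • f) i)
      (trans (*-congˡ (coeff-• b f i))
        (trans (sym (*-assoc a b _)) (sym (coeff-• (a * b) f i))))

  0• : ∀ f → 0# • f ≋ []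
  0• f = mk≋ λ i → trans (coeff-• 0# f i) (zeroˡ _)

  1• : ∀ f → 1# • f ≋ f
  1• f = mk≋ λ i → trans (coeff-• 1# f i) (*-identityˡ _)

  0∷-⊗ : ∀ f g → (0# ∷ f) ⊗ g ≋ 0# ∷ f ⊗ g
  0∷-⊗ f g = ⊕-cong (0• g) ≋-refl

  ⊗-congˡ : ∀ f {g h} → g ≋ h → f ⊗ g ≋ f ⊗ h
  ⊗-congˡ []      p = ≋-refl
  ⊗-congˡ (a ∷ f) p = ⊕-cong (•-cong refl p) (∷-cong refl (⊗-congˡ f p))

  ⊗-zeroʳ : ∀ f → f ⊗ [] ≋ []
  ⊗-zeroʳ []      = ≋-refl
  ⊗-zeroʳ (a ∷ f) = ≋-trans (∷-cong refl (⊗-zeroʳ f)) 0∷[]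

  ⊗-∷ : ∀ f b g → f ⊗ (b ∷ g) ≋ b • f ⊕ (0# ∷ f ⊗ g)
  ⊗-∷ []      b g = ≋-sym 0∷[]
  ⊗-∷ (a ∷ f) b g = ∷-cong (+-congʳ (*-comm a b))
    (≋-trans (⊕-cong (≋-refl {a • g}) (⊗-∷ f b g))
      (≋-trans (≋-sym (⊕-assoc (a • g) (b • f) _))
        (≋-trans (⊕-cong (⊕-comm (a • g) (b • f)) ≋-refl)
          (⊕-assoc (b • f) (a • g) _))))

  ⊗-comm : ∀ f g → f ⊗ g ≋ g ⊗ f
  ⊗-comm []      g = ≋-sym (⊗-zeroʳ g)
  ⊗-comm (a ∷ f) g =
    ≋-trans (⊕-cong (≋-refl {a • g}) (∷-cong refl (⊗-comm f g)))
      (≋-sym (⊗-∷ g a f))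

  ⊗-cong : ∀ {f f′ g g′} → f ≋ f′ → g ≋ g′ → f ⊗ g ≋ f′ ⊗ g′
  ⊗-cong {f} {f′} {g} {g′} p q =
    ≋-trans (⊗-congˡ f q)
      (≋-trans (⊗-comm f g′) (≋-trans (⊗-congˡ g′ p) (⊗-comm g′ f′)))

  ⊗-distribʳ : ∀ h f g → (f ⊕ g) ⊗ h ≋ f ⊗ h ⊕ g ⊗ h
  ⊗-distribʳ h []      g       = ≋-refl
  ⊗-distribʳ h (a ∷ f) []      = ≋-sym (⊕-identityʳ _)
  ⊗-distribʳ h (a ∷ f) (b ∷ g) =
    ≋-trans
      (⊕-cong (•-distribʳ-+ a b h)
        (∷-cong (sym (+-identityˡ 0#)) (⊗-distribʳ h f g)))
      (⊕-interchange (a • h) (b • h) (0# ∷ f ⊗ h) (0# ∷ g ⊗ h))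

  •-⊗ : ∀ a f g → (a • f) ⊗ g ≋ a • (f ⊗ g)
  •-⊗ a []      g = ≋-refl
  •-⊗ a (b ∷ f) g =
    ≋-trans
      (⊕-cong (≋-sym (•-assoc a b g)) (∷-cong (sym (zeroʳ a)) (•-⊗ a f g)))
      (≋-sym (•-distribˡ-⊕ a (b • g) (0# ∷ f ⊗ g)))

  ⊗-assoc : ∀ f g h → (f ⊗ g) ⊗ h ≋ f ⊗ (g ⊗ h)
  ⊗-assoc []      g h = ≋-refl
  ⊗-assoc (a ∷ f) g h =
    ≋-trans (⊗-distribʳ h (a • g) (0# ∷ f ⊗ g))
      (⊕-cong (•-⊗ a g h)
        (≋-trans (0∷-⊗ (f ⊗ g) h) (∷-cong refl (⊗-assoc f g h))))

  ⊗-identityˡ : ∀ f → const 1# ⊗ f ≋ f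
  ⊗-identityˡ f =
    ≋-trans (⊕-cong (1• f) 0∷[]) (⊕-identityʳ f)

infix 9 _[X]
_[X] : CommutativeRing c ℓ → CommutativeRing c ℓ
R [X] = record
  { Carrier = Poly
  ; _≈_     = _≋_
  ; _+_     = _⊕_
  ; _*_     = _⊗_
  ; -_      = ⊝_
  ; 0#      = []
  ; 1#      = const 1#
  ; isCommutativeRing = record
    { isRing = record
      { +-isAbelianGroup = record
        { isGroup = record
          { isMonoid = record
            { isSemigroup = record
              { isMagma = record
                { isEquivalence = ≋-isEquivalence
                ; ∙-cong        = ⊕-cong
                }
              ; assoc = ⊕-assoc
              }
            ; identity = (λ f → ≋.refl) , ⊕-identityʳ
            }
          ; inverse = (λ f → ≋.trans (⊕-comm (⊝ f) f) (⊕-inverseʳ f)) , ⊕-inverseʳ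
          ; ⁻¹-cong = ⊝-cong
          }
        ; comm = ⊕-comm
        }
      ; *-cong     = ⊗-cong
      ; *-assoc    = ⊗-assoc
      ; *-identity = ⊗-identityˡ
                   , λ f → ≋.trans (⊗-comm f (const 1#)) (⊗-identityˡ f)
      ; distrib    = (λ f g h → ≋.trans (⊗-comm f (g ⊕ h))
                       (≋.trans (⊗-distribʳ f g h)
                         (⊕-cong (⊗-comm g f) (⊗-comm h f))))
                   , ⊗-distribʳ
      }
    ; *-comm = ⊗-comm
    }
  }
  where
  open CommutativeRing R using (1#)
  open Polynomials R
  module ≋ = IsEquivalence ≋-isEquivalence

module _ (R : CommutativeRing c ℓ) where
  open CommutativeRing R
  open MonoidMult +-monoid using () renaming (_×_ to infixr 8 _×ᴿ_)

  ∏ : List ℕ → (ℕ → Carrier) → Carrier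
  ∏ ds f = foldr _*_ 1# (map f ds)

  fromℤ : ℤ → Carrier
  fromℤ (+ n)    = n ×ᴿ 1#
  fromℤ -[1+ n ] = - (suc n ×ᴿ 1#)

record Field (c ℓ : Level) : Set (lsuc (c ⊔ ℓ)) where
  field
    commutativeRing : CommutativeRing c ℓ
  open CommutativeRing commutativeRing public
  field
    _≟_     : Decidable _≈_
    1≉0     : 1# ≉ 0#
    inverse : ∀ x → x ≉ 0# → ∃[ y ] x * y ≈ 1#

  open SemiringExp semiring public using () renaming (_^_ to infixr 8 _^_)

  -- Division by zero returns the junk value 0#.
  infixl 7 _/_
  _/_ : Carrier → Carrier → Carrier
  x / y with y ≟ 0#
  ... | yes _  = 0#
  ... | no y≉0 = x * proj₁ (inverse y y≉0)

HasCardinality : Field c ℓ → ℕ → Set (c ⊔ ℓ)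
HasCardinality F q = Bijection (Field.setoid F) (≡.setoid (Fin q))

-- L is an algebraic closure of the field of fractions of the domain D.  The
-- fraction field is realised as its copy inside L: an injective ring
-- homomorphism D → L into a field extends uniquely to Frac D.
record IsAlgebraicClosureOfFrac
    (D : CommutativeRing c ℓ) (L : Field c′ ℓ′)
    (ι : CommutativeRing.Carrier D → Field.Carrier L) :
    Set (c ⊔ ℓ ⊔ c′ ⊔ ℓ′) where
  private
    module D = CommutativeRing D
    module L = Field L
    module L[X] = CommutativeRing (L.commutativeRing [X])
  open Polynomials L.commutativeRing
  open L using (_/_)

  field
    isRingMonomorphism : IsRingMonomorphism D.rawRing L.rawRing ι

  IsFraction : L.Carrier → Set (c ⊔ ℓ ⊔ ℓ′)
  IsFraction y = ∃[ a ] ∃[ b ] (b D.≉ D.0#) × (y L.≈ ι a / ι b)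

  field
    algebraic : ∀ x → ∃[ f ]
      (f L[X].≉ L[X].0#) × All IsFraction f × (eval f x L.≈ L.0#)
    algebraicallyClosed : ∀ f i → coeff f (suc i) L.≉ L.0# →
      ∃[ x ] eval f x L.≈ L.0#

φ : ℕ → ℕ
φ n = length (filter (λ k → coprime? k n) (map suc (upTo n)))

properDivisors : ℕ → List ℕ
properDivisors n = filter (_∣? n) (upTo n)

module Cyclotomic where
  ℤ-ring : CommutativeRing _ _
  ℤ-ring = ℤₚ.+-*-commutativeRing
  open Polynomials ℤ-ring

  degree : Poly → ℕ
  degree []      = 0
  degree (a ∷ f) =
    if does (all? (ℤₚ._≟ 0ℤ) f) then 0 else suc (degree f)

  -- Long division by a polynomial g that is monic of degree m, returning
  -- (quotient , remainder).  If f = q·g + r and t is the coefficient of Xᵐ in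
  -- a + X·r, then a + X·f = (t + X·q)·g + (a + X·r - t·g).
  divStep : ℕ → Poly → ℤ → Poly × Poly → Poly × Poly
  divStep m g a (q , r) =
    let t = coeff (a ∷ r) m in t ∷ q , (a ∷ r) ⊕ ⊝ (t • g)

  divMod : Poly → Poly → Poly × Poly
  divMod f g = foldr (divStep (degree g) g) ([] , []) f

  Xⁿ-1 : ℕ → Poly
  Xⁿ-1 zero    = []
  Xⁿ-1 (suc n) = -1ℤ ∷ replicate n 0ℤ ++ 1ℤ ∷ []

  -- The first argument is fuel; n of it suffice for the n-th polynomial,
  -- because proper divisors are smaller.  The value at fuel 0 serves only n = 0,
  -- which has no meaning.
  Φ-fuel : ℕ → ℕ → Poly
  Φ-fuel zero    _ = const 1ℤ
  Φ-fuel (suc k) n =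
    proj₁ (divMod (Xⁿ-1 n) (∏ (ℤ-ring [X]) (properDivisors n) (Φ-fuel k)))

  -- The n-th cyclotomic polynomial over ℤ: Φ n = (Xⁿ - 1) / ∏ (Φ d), the
  -- product running over the proper divisors d of n.
  Φ : ℕ → Poly
  Φ n = Φ-fuel n n

-- F[B,C] is F[B][C]: C is the outer variable.
module LucasPolynomials (F : Field c ℓ) where
  private
    R = Field.commutativeRing F
    module F[B] = Polynomials R
    module F[B][C] = Polynomials (R [X])

  F[B,C] : CommutativeRing c ℓ
  F[B,C] = (R [X]) [X]

  open CommutativeRing F[B,C]

  constant : Field.Carrier F → Carrier
  constant a = F[B][C].const (F[B].const a)

  B C : Carrier
  B = F[B][C].const F[B].X
  C = F[B][C].X

  𝒰 : ℕ → Carrier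
  𝒰 zero          = 0#
  𝒰 (suc zero)    = 1#
  𝒰 (suc (suc n)) = - B * 𝒰 (suc n) - C * 𝒰 n

  𝒱 : ℕ → Carrier
  𝒱 zero          = 1# + 1#
  𝒱 (suc zero)    = - B
  𝒱 (suc (suc n)) = - B * 𝒱 (suc n) - C * 𝒱 n

  -- The image over F of the integral cyclotomic polynomial.
  Φ-over : ℕ → F[B].Poly
  Φ-over n = map (fromℤ R) (Cyclotomic.Φ n)

  module _ (L : Field c′ ℓ′) (ι : Carrier → Field.Carrier L) where
    private
      module L = Field L
    open L using (_/_; _^_)
    open Polynomials L.commutativeRing

    -- T² + B T + C = (T - α) (T - β) in L[T].
    AreTheRoots : L.Carrier → L.Carrier → Set ℓ′
    AreTheRoots α β =
      (ι C ∷ ι B ∷ L.1# ∷ []) ≋ (L.- α ∷ L.1# ∷ []) ⊗ (L.- β ∷ L.1# ∷ [])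

    -- The division is genuine when α and β are the roots above, since then
    -- α β = C ≠ 0.
    Φʰᵒᵐ : ℕ → L.Carrier → L.Carrier → L.Carrier
    Φʰᵒᵐ n α β = β ^ φ n L.* eval (map (ι ∘ constant) (Φ-over n)) (α / β)

    -- Λ n is the only element of F[B,C] with the stated image when ι is
    -- injective.  Λ 0 is left arbitrary.
    IsLucasAtoms : L.Carrier → L.Carrier → (ℕ → Carrier) → Set (ℓ ⊔ ℓ′)
    IsLucasAtoms α β Λ =
      Λ 1 ≈ 1# × (∀ n → 2 ≤ n → ι (Λ n) L.≈ Φʰᵒᵐ n α β)

{-# OPTIONS --safe #-}
-- Write D m for the product of the Φ d over the divisors d of m.  Over ℤ, D n = Xⁿ - 1 by
-- strong induction.  Bézout's identity in ℕ makes X^gcd(m,n) - 1 a ℤ[X]-combination of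
-- Xᵐ - 1 and Xⁿ - 1.  Dividing by D (gcd m n) shows that Φ m and Φ n are comaximal whenever
-- neither of m, n divides the other, so the Φ d of the proper divisors d of n may be split
-- off Xⁿ - 1 one after the other, and the long division defining Φ n is exact.
--
-- Evaluating at α/β and multiplying by βⁿ, where n = ∑ φ d over d ∣ n, gives
-- ∏ Φʰᵒᵐ d = αⁿ - βⁿ.  Now (α - β) 𝒰 n = αⁿ - βⁿ and 𝒱 n = αⁿ + βⁿ, so cancelling
-- Φʰᵒᵐ 1 = α - β gives the first identity, and cancelling αⁿ - βⁿ from
-- α²ⁿ - β²ⁿ = (αⁿ - βⁿ)(αⁿ + βⁿ) gives the second.  The cancelled factors are nonzero
-- because 𝒰 n and the discriminant B² - 4C become 1 at B = -1, C = 0.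
module Submission where

open import Defs
open import Algebra.Bundles using (CommutativeMonoid; CommutativeRing)
import Algebra.Morphism.Construct.Composition as Composition
import Algebra.Morphism.Construct.Identity as Identity
open import Algebra.Morphism.Structures
  using (IsMonoidHomomorphism; IsRingHomomorphism; IsRingMonomorphism)
import Algebra.Properties.AbelianGroup as AbelianGroupProperties
import Algebra.Properties.CommutativeSemigroup as CommutativeSemigroupProperties
import Algebra.Properties.CommutativeSemiring.Exp as CommutativeSemiringExp
import Algebra.Properties.Ring as RingProperties
import Algebra.Properties.Semiring.Exp as SemiringExp
import Algebra.Properties.Semiring.Mult as SemiringMult
import Algebra.Solver.Ring as RingSolver
open import Algebra.Solver.Ring.AlmostCommutativeRing
  using (_-Raw-AlmostCommutative⟶_; Induced-equivalence; fromCommutativeRing)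
open import Data.Bool.Base using (if_then_else_; true; false)
open import Data.Integer.Base as ℤ using (ℤ; +_; -[1+_]; 0ℤ; 1ℤ)
import Data.Integer.Properties as ℤₚ
open import Data.List.Base
  using (List; []; _∷_; _++_; _∷ʳ_; map; foldr; filter; length; upTo; replicate)
open import Data.List.Membership.Propositional.Properties using (∈-filter⁻; ∈-upTo⁻)
open import Data.List.Properties
  using (++-identityʳ; filter-++; map-++; map-∘; map-cong-local; upTo-∷ʳ)
open import Data.List.Relation.Unary.All as All using (All; all?; []; _∷_)
import Data.Maybe.Base as Maybe
open import Data.Nat.Base as ℕ using (ℕ; zero; suc; _≤_; _<_; z≤n; s≤s; z<s; >-nonZero)
open import Data.Nat.Coprimality using (Coprime; coprime?; coprime⇒gcd≡1; gcd≡1⇒coprime)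
open import Data.Nat.Divisibility
  using (_∣_; _∤_; _∣?_; divides; ∣-refl; ∣-trans; ∣⇒≤; >⇒∤; 0∣⇒≡0; 1∣_; n∣m*n; ∣m+n∣m⇒∣n)
open import Data.Nat.GCD
  using (gcd; gcd-GCD; gcd[m,n]∣m; gcd[m,n]∣n; c*gcd[m,n]≡gcd[cm,cn]; module Bézout)
open import Data.Nat.Induction using (<-rec)
open import Data.Nat.Primality using (Prime)
import Data.Nat.Properties as ℕₚ
open import Data.Nat.Properties using (_<?_)
open import Data.Product.Base using (_×_; _,_; proj₁; proj₂; ∃-syntax)
open import Data.Sum.Base using (_⊎_; inj₁; inj₂)
open import Function.Base using (_∘_; id)
open import Level using (Level)
open import Relation.Binary.Definitions using (WeaklyDecidable; tri<; tri≈; tri>)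
open import Relation.Binary.PropositionalEquality as ≡ using (_≡_; _≢_)
import Relation.Binary.Reasoning.Setoid as SetoidReasoning
open import Relation.Nullary.Decidable
  using (Dec; yes; no; does; _×-dec_; ¬?; dec-true; dec-false; dec⇒maybe)
open import Relation.Nullary.Negation using (¬_; contradiction)
open import Relation.Unary using (Pred; Decidable)

private variable
  c ℓ c′ ℓ′ p q : Level

-- Big operators over initial segments of ℕ

module BigOperator (M : CommutativeMonoid c ℓ) where
  open CommutativeMonoid M
  open CommutativeSemigroupProperties commutativeSemigroup using (interchange)
  open SetoidReasoning setoid

  -- Excluded factors become `ε` instead of being removed. Products over different sets of divisors
  -- then share one index range and can be split, multiplied and interchanged pointwise.
  when : {P : Set p} → Dec P → Carrier → Carrier
  when P? x = if does P? then x else ε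

  when-yes : {P : Set p} (P? : Dec P) {x : Carrier} → P → when P? x ≡ x
  when-yes P? {x} p = ≡.cong (if_then x else ε) (dec-true P? p)

  when-no : {P : Set p} (P? : Dec P) {x : Carrier} → ¬ P → when P? x ≡ ε
  when-no P? {x} ¬p = ≡.cong (if_then x else ε) (dec-false P? ¬p)

  big : ℕ → (ℕ → Carrier) → Carrier
  big zero    f = ε
  big (suc n) f = big n f ∙ f n

  big-cong : ∀ n {f g} → (∀ i → i < n → f i ≈ g i) → big n f ≈ big n g
  big-cong zero    f≈g = refl
  big-cong (suc n) f≈g =
    ∙-cong (big-cong n λ i i<n → f≈g i (ℕₚ.m<n⇒m<1+n i<n)) (f≈g n (ℕₚ.n<1+n n))

  big-ε : ∀ n {f} → (∀ i → i < n → f i ≈ ε) → big n f ≈ ε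
  big-ε zero    f≈ε = refl
  big-ε (suc n) f≈ε = trans
    (∙-cong (big-ε n λ i i<n → f≈ε i (ℕₚ.m<n⇒m<1+n i<n)) (f≈ε n (ℕₚ.n<1+n n)))
    (identityˡ ε)

  big-∙ : ∀ n f g → big n (λ i → f i ∙ g i) ≈ big n f ∙ big n g
  big-∙ zero    f g = sym (identityˡ ε)
  big-∙ (suc n) f g = trans (∙-congʳ (big-∙ n f g)) (interchange _ _ _ _)

  big-+ : ∀ m n f → big (n ℕ.+ m) f ≈ big m f ∙ big n (λ i → f (i ℕ.+ m))
  big-+ m zero    f = sym (identityʳ _)
  big-+ m (suc n) f = trans (∙-congʳ (big-+ m n f)) (assoc _ _ _)

  big-swap : ∀ m n (f : ℕ → ℕ → Carrier) →
    big m (λ i → big n (f i)) ≈ big n (λ j → big m (λ i → f i j))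
  big-swap zero    n f = sym (big-ε n λ _ _ → refl)
  big-swap (suc m) n f = trans (∙-congʳ (big-swap m n f)) (sym (big-∙ n _ (f m)))

  big-extend : ∀ {m n} f → m ≤ n → (∀ i → m ≤ i → f i ≈ ε) → big n f ≈ big m f
  big-extend {m} {n} f m≤n f≈ε = begin
    big n f                 ≡⟨ ≡.cong (λ k → big k f) (ℕₚ.m∸n+n≡m m≤n) ⟨
    big (n ℕ.∸ m ℕ.+ m) f   ≈⟨ big-+ m (n ℕ.∸ m) f ⟩
    big m f ∙ _             ≈⟨ ∙-congˡ (big-ε (n ℕ.∸ m) λ i _ → f≈ε _ (ℕₚ.m≤n+m m i)) ⟩
    big m f ∙ ε             ≈⟨ identityʳ _ ⟩
    big m f                 ∎

  big-factor : ∀ {i n} f → i < n → ∃[ r ] big n f ≈ f i ∙ r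
  big-factor {i} {suc n} f i<1+n with i ℕₚ.≟ n
  ... | yes ≡.refl = big n f , comm _ _
  ... | no i≢n with big-factor f (ℕₚ.≤∧≢⇒< (ℕₚ.≤-pred i<1+n) i≢n)
  ...   | r , eq = r ∙ f n , trans (∙-congʳ eq) (assoc _ _ _)

  big-single : ∀ {j n} f → j < n → (∀ i → i < n → i ≢ j → f i ≈ ε) → big n f ≈ f j
  big-single {j} {suc n} f j<1+n f≈ε with j ℕₚ.≟ n
  ... | yes ≡.refl = trans
    (∙-congʳ (big-ε n λ i i<n → f≈ε i (ℕₚ.m<n⇒m<1+n i<n) (ℕₚ.<⇒≢ i<n)))
    (identityˡ _)
  ... | no j≢n = trans
    (∙-cong (big-single f (ℕₚ.≤∧≢⇒< (ℕₚ.≤-pred j<1+n) j≢n)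
              λ i i<n → f≈ε i (ℕₚ.m<n⇒m<1+n i<n))
            (f≈ε n (ℕₚ.n<1+n n) (j≢n ∘ ≡.sym)))
    (identityʳ _)

  when-cong : {P : Set p} (P? : Dec P) {x y : Carrier} → (P → x ≈ y) → when P? x ≈ when P? y
  when-cong (yes p) x≈y = x≈y p
  when-cong (no _)  _   = refl

  when-⇔ : {P : Set p} {Q : Set q} (P? : Dec P) (Q? : Dec Q) → (P → Q) → (Q → P) →
    ∀ x → when P? x ≈ when Q? x
  when-⇔ (yes _) (yes _) _   _   x = refl
  when-⇔ (yes p) (no ¬q) P⇒Q _   x = contradiction (P⇒Q p) ¬q
  when-⇔ (no ¬p) (yes q) _   Q⇒P x = contradiction (Q⇒P q) ¬p
  when-⇔ (no _)  (no _)  _   _   x = refl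

  when-∙ : {P : Set p} (P? : Dec P) → ∀ x y → when P? (x ∙ y) ≈ when P? x ∙ when P? y
  when-∙ (yes _) x y = refl
  when-∙ (no _)  x y = sym (identityˡ ε)

  when-split : {P : Set p} {Q : Set q} (P? : Dec P) (Q? : Dec Q) → (Q → P) → ∀ x →
    when P? x ≈ when Q? x ∙ when (P? ×-dec ¬? Q?) x
  when-split (yes _) (yes _) _   x = sym (identityʳ x)
  when-split (yes _) (no _)  _   x = sym (identityˡ x)
  when-split (no ¬p) (yes q) Q⇒P x = contradiction (Q⇒P q) ¬p
  when-split (no _)  (no _)  _   x = sym (identityˡ ε)

  -- In the applications P is divisibility of n, and Q is either divisibility of some divisor of n
  -- or P together with 1 < d.
  big-split : {P : Pred ℕ p} {Q : Pred ℕ q} (P? : Decidable P) (Q? : Decidable Q) →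
    (∀ i → Q i → P i) → ∀ n (f : ℕ → Carrier) →
    big n (λ i → when (P? i) (f i)) ≈
    big n (λ i → when (Q? i) (f i)) ∙ big n (λ i → when (P? i ×-dec ¬? (Q? i)) (f i))
  big-split P? Q? Q⇒P n f = trans
    (big-cong n λ i _ → when-split (P? i) (Q? i) (Q⇒P i) (f i))
    (big-∙ n (λ i → when (Q? i) (f i)) (λ i → when (P? i ×-dec ¬? (Q? i)) (f i)))

  foldr-∷ʳ : ∀ xs y → foldr _∙_ ε (xs ∷ʳ y) ≈ foldr _∙_ ε xs ∙ y
  foldr-∷ʳ []       y = comm y ε
  foldr-∷ʳ (x ∷ xs) y = trans (∙-congˡ (foldr-∷ʳ xs y)) (sym (assoc _ _ _))

  -- Passes from the filtered lists in the definitions to `big`. The induction removes the last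
  -- entry of `upTo`, since `big` grows at its upper end.
  foldr-filter : {P : Pred ℕ p} (P? : Decidable P) → ∀ f n →
    foldr _∙_ ε (map f (filter P? (upTo n))) ≈ big n (λ i → when (P? i) (f i))
  foldr-filter P? f zero    = refl
  foldr-filter P? f (suc n) = begin
    fold (filter P? (upTo (suc n)))             ≡⟨ ≡.cong (fold ∘ filter P?) (upTo-∷ʳ n) ⟨
    fold (filter P? (upTo n ∷ʳ n))              ≡⟨ ≡.cong fold (filter-++ P? (upTo n) _) ⟩
    fold (filter P? (upTo n) ++ filter P? (n ∷ [])) ≈⟨ last ⟩
    fold (filter P? (upTo n)) ∙ when (P? n) (f n)   ≈⟨ ∙-congʳ (foldr-filter P? f n) ⟩
    big (suc n) (λ i → when (P? i) (f i))       ∎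
    where
    fold : List ℕ → Carrier
    fold = foldr _∙_ ε ∘ map f

    last : fold (filter P? (upTo n) ++ filter P? (n ∷ []))
         ≈ fold (filter P? (upTo n)) ∙ when (P? n) (f n)
    last with does (P? n)
    ... | true  = trans (reflexive (≡.cong (foldr _∙_ ε) (map-++ f (filter P? (upTo n)) _)))
                        (foldr-∷ʳ (map f (filter P? (upTo n))) (f n))
    ... | false = trans (reflexive (≡.cong fold (++-identityʳ (filter P? (upTo n)))))
                        (sym (identityʳ _))

module BigHomomorphism (M : CommutativeMonoid c ℓ) (N : CommutativeMonoid c′ ℓ′)
  (h : CommutativeMonoid.Carrier M → CommutativeMonoid.Carrier N)
  (h-hom : IsMonoidHomomorphism (CommutativeMonoid.rawMonoid M) (CommutativeMonoid.rawMonoid N) h)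
  where
  private
    module M = BigOperator M
    module N = BigOperator N
  open CommutativeMonoid N
  open IsMonoidHomomorphism h-hom

  when-homo : {P : Set p} (P? : Dec P) → ∀ x → h (M.when P? x) ≈ N.when P? (h x)
  when-homo (yes _) x = refl
  when-homo (no _)  x = ε-homo

  big-homo : ∀ n f → h (M.big n f) ≈ N.big n (λ i → h (f i))
  big-homo zero    f = ε-homo
  big-homo (suc n) f = trans (homo _ _) (∙-congʳ (big-homo n f))

  big-when-homo : {P : Pred ℕ p} (P? : Decidable P) → ∀ n (f : ℕ → CommutativeMonoid.Carrier M) →
    h (M.big n (λ i → M.when (P? i) (f i))) ≈ N.big n (λ i → N.when (P? i) (h (f i)))
  big-when-homo P? n f = trans (big-homo n _) (N.big-cong n λ i _ → when-homo (P? i) (f i))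

-- The homomorphism from ℤ and the ring solver

module FromℤHomomorphism (R : CommutativeRing c ℓ) where
  open CommutativeRing R
  open RingProperties ring
  open AbelianGroupProperties +-abelianGroup using (⁻¹-∙-comm; ⁻¹-involutive)
  open SemiringMult semiring using (×-homo-+; ×1-homo-*) renaming (_×_ to _×ᴿ_)
  open SetoidReasoning setoid

  fromℤ-neg : ∀ i → fromℤ R (ℤ.- i) ≈ - fromℤ R i
  fromℤ-neg (+ zero)   = sym -0#≈0#
  fromℤ-neg (+ suc n)  = refl
  fromℤ-neg -[1+ n ]   = sym (⁻¹-involutive _)

  fromℤ-⊖ : ∀ m n → fromℤ R (m ℤ.⊖ n) ≈ m ×ᴿ 1# - n ×ᴿ 1#
  fromℤ-⊖ zero    (suc n) = sym (+-identityˡ _)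
  fromℤ-⊖ m       zero    = sym (trans (+-congˡ -0#≈0#) (+-identityʳ _))
  fromℤ-⊖ (suc m) (suc n) = begin
    fromℤ R (suc m ℤ.⊖ suc n)        ≡⟨ ≡.cong (fromℤ R) (ℤₚ.[1+m]⊖[1+n]≡m⊖n m n) ⟩
    fromℤ R (m ℤ.⊖ n)                ≈⟨ fromℤ-⊖ m n ⟩
    x - y                            ≈⟨ +-congʳ (+-identityˡ x) ⟨
    0# + x - y                       ≈⟨ +-congʳ (+-congʳ (-‿inverseʳ 1#)) ⟨
    1# - 1# + x - y                  ≈⟨ +-congʳ (+-assoc _ _ _) ⟩
    1# + (- 1# + x) - y              ≈⟨ +-congʳ (+-congˡ (+-comm _ _)) ⟩
    1# + (x - 1#) - y                ≈⟨ +-congʳ (+-assoc _ _ _) ⟨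
    1# + x - 1# - y                  ≈⟨ +-assoc _ _ _ ⟩
    1# + x + (- 1# - y)              ≈⟨ +-congˡ (⁻¹-∙-comm 1# y) ⟩
    1# + x - (1# + y)                ∎
    where
    x = m ×ᴿ 1#
    y = n ×ᴿ 1#

  fromℤ-+ : ∀ i j → fromℤ R (i ℤ.+ j) ≈ fromℤ R i + fromℤ R j
  fromℤ-+ (+ m)    (+ n)    = ×-homo-+ 1# m n
  fromℤ-+ (+ m)    -[1+ n ] = fromℤ-⊖ m (suc n)
  fromℤ-+ -[1+ m ] (+ n)    = trans (fromℤ-⊖ n (suc m)) (+-comm _ _)
  fromℤ-+ -[1+ m ] -[1+ n ] = begin
    - (suc (suc (m ℕ.+ n)) ×ᴿ 1#)        ≡⟨ ≡.cong (λ k → - (suc k ×ᴿ 1#)) (ℕₚ.+-suc m n) ⟨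
    - ((suc m ℕ.+ suc n) ×ᴿ 1#)          ≈⟨ -‿cong (×-homo-+ 1# (suc m) (suc n)) ⟩
    - (suc m ×ᴿ 1# + suc n ×ᴿ 1#)        ≈⟨ ⁻¹-∙-comm _ _ ⟨
    - (suc m ×ᴿ 1#) - suc n ×ᴿ 1#        ∎

  private
    fromℤ-pos-* : ∀ m j → fromℤ R (+ m ℤ.* j) ≈ fromℤ R (+ m) * fromℤ R j
    fromℤ-pos-* m (+ n) =
      trans (reflexive (≡.cong (fromℤ R) (≡.sym (ℤₚ.pos-* m n)))) (×1-homo-* m n)
    fromℤ-pos-* m -[1+ n ] = begin
      fromℤ R (+ m ℤ.* -[1+ n ])            ≡⟨ ≡.cong (fromℤ R) (ℤₚ.neg-distribʳ-* (+ m) (+ suc n)) ⟨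
      fromℤ R (ℤ.- (+ m ℤ.* + suc n))       ≈⟨ fromℤ-neg (+ m ℤ.* + suc n) ⟩
      - fromℤ R (+ m ℤ.* + suc n)           ≈⟨ -‿cong (fromℤ-pos-* m (+ suc n)) ⟩
      - (fromℤ R (+ m) * fromℤ R (+ suc n)) ≈⟨ -‿distribʳ-* _ _ ⟩
      fromℤ R (+ m) * fromℤ R -[1+ n ]      ∎

  fromℤ-* : ∀ i j → fromℤ R (i ℤ.* j) ≈ fromℤ R i * fromℤ R j
  fromℤ-* (+ m)    j = fromℤ-pos-* m j
  fromℤ-* -[1+ m ] j = begin
    fromℤ R (-[1+ m ] ℤ.* j)           ≡⟨ ≡.cong (fromℤ R) (ℤₚ.neg-distribˡ-* (+ suc m) j) ⟨
    fromℤ R (ℤ.- (+ suc m ℤ.* j))      ≈⟨ fromℤ-neg (+ suc m ℤ.* j) ⟩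
    - fromℤ R (+ suc m ℤ.* j)          ≈⟨ -‿cong (fromℤ-pos-* (suc m) j) ⟩
    - (fromℤ R (+ suc m) * fromℤ R j)  ≈⟨ -‿distribˡ-* _ _ ⟩
    fromℤ R -[1+ m ] * fromℤ R j       ∎

  fromℤ-1 : fromℤ R ℤ.1ℤ ≈ 1#
  fromℤ-1 = +-identityʳ 1#

-- Coefficients are integers, whose equality is decidable even when that of the ring is not. No
-- constants are exported, so `0#` and `1#` enter the solved identities as variables.
module CommutativeRingSolver (R : CommutativeRing c ℓ) where
  open FromℤHomomorphism R
  open CommutativeRing R using (reflexive; refl)

  fromℤ-morphism : ℤ.+-*-rawRing -Raw-AlmostCommutative⟶ fromCommutativeRing R
  fromℤ-morphism = record
    { ⟦_⟧    = fromℤ R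
    ; +-homo = fromℤ-+
    ; *-homo = fromℤ-*
    ; -‿homo = fromℤ-neg
    ; 0-homo = refl
    ; 1-homo = fromℤ-1
    }

  fromℤ-≟ : WeaklyDecidable (Induced-equivalence fromℤ-morphism)
  fromℤ-≟ i j = Maybe.map (λ i≡j → reflexive (≡.cong (fromℤ R) i≡j)) (dec⇒maybe (i ℤₚ.≟ j))

  open RingSolver ℤ.+-*-rawRing (fromCommutativeRing R) fromℤ-morphism fromℤ-≟ public
    using (solve; _:=_; _:+_; _:*_; _:-_; :-_)

-- Comaximality and products over divisors

∣⇒0< : ∀ {d n} → 0 < n → d ∣ n → 0 < d
∣⇒0< {zero}  0<n 0∣n = contradiction (≡.sym (0∣⇒≡0 0∣n)) (ℕₚ.<⇒≢ 0<n)
∣⇒0< {suc d} _   _   = ℕ.z<s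

<⇒∤ : ∀ {d n} → 0 < n → n < d → d ∤ n
<⇒∤ 0<n n<d = >⇒∤ {{>-nonZero 0<n}} n<d

module Regularity (R : CommutativeRing c ℓ) where
  open CommutativeRing R
  open CommutativeRingSolver R
  open RingProperties ring using (-‿distribʳ-*; x∙y⁻¹≈ε⇒x≈y)
  open BigOperator *-commutativeMonoid
  open SetoidReasoning setoid

  -- Non-zero-divisors are exactly what cancellation requires; the notion covers monic integer
  -- polynomials and nonzero field elements alike.
  Regular : Carrier → Set _
  Regular x = ∀ {y} → x * y ≈ 0# → y ≈ 0#

  regular-cancel : ∀ {x y z} → Regular x → x * y ≈ x * z → y ≈ z
  regular-cancel {x} {y} {z} reg xy≈xz = x∙y⁻¹≈ε⇒x≈y y z (reg (begin
    x * (y - z)      ≈⟨ solve 3 (λ x y z → x :* (y :- z) := x :* y :- x :* z) refl x y z ⟩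
    x * y - x * z    ≈⟨ +-congʳ xy≈xz ⟩
    x * z - x * z    ≈⟨ -‿inverseʳ _ ⟩
    0#               ∎))

  regular-factor : ∀ {x y z} → z ≈ x * y → Regular z → Regular x
  regular-factor {x} {y} {z} z≈xy reg {w} xw≈0 = reg (begin
    z * w            ≈⟨ *-congʳ z≈xy ⟩
    x * y * w        ≈⟨ solve 3 (λ x y w → x :* y :* w := y :* (x :* w)) refl x y w ⟩
    y * (x * w)      ≈⟨ *-congˡ xw≈0 ⟩
    y * 0#           ≈⟨ zeroʳ y ⟩
    0#               ∎)

  Comaximal : Carrier → Carrier → Set _
  Comaximal x y = ∃[ u ] ∃[ v ] u * x + v * y ≈ 1#

  comaximal-1 : ∀ {x} → Comaximal 1# x
  comaximal-1 {x} = 1# , 0# , trans (+-cong (*-identityˡ 1#) (zeroˡ x)) (+-identityʳ 1#)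

  comaximal-* : ∀ {x y z} → Comaximal x z → Comaximal y z → Comaximal (x * y) z
  comaximal-* {x} {y} {z} (u , v , eq) (s , t , eq′) =
    -- Multiplying the two relations gives 1 = (u x + v z)(s y + t z), in which every term except u
    -- s x y contains z.
    u * s , u * x * t + v * s * y + v * t * z , (begin
      u * s * (x * y) + (u * x * t + v * s * y + v * t * z) * z
        ≈⟨ solve 7 (λ x y z u v s t →
             u :* s :* (x :* y) :+ (u :* x :* t :+ v :* s :* y :+ v :* t :* z) :* z :=
             (u :* x :+ v :* z) :* (s :* y :+ t :* z)) refl x y z u v s t ⟩
      (u * x + v * z) * (s * y + t * z)  ≈⟨ *-cong eq eq′ ⟩
      1# * 1#                            ≈⟨ *-identityˡ 1# ⟩
      1#                                 ∎)

  comaximal-big : ∀ {z} n f → (∀ i → i < n → Comaximal (f i) z) → Comaximal (big n f) z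
  comaximal-big zero    f _ = comaximal-1
  comaximal-big (suc n) f h = comaximal-*
    (comaximal-big n f λ i i<n → h i (ℕₚ.m<n⇒m<1+n i<n)) (h n (ℕₚ.n<1+n n))

  -- To be read with `a n` as Xⁿ - 1 and `b n` as `Φ n`. The assumption `a-gcd` is the
  -- ideal-theoretic form of strong divisibility.
  module DivisorProducts (a b : ℕ → Carrier)
    (a-regular : ∀ {n} → 0 < n → Regular (a n))
    (a-∣ : ∀ {d n} → d ∣ n → ∃[ y ] a n ≈ a d * y)
    (a-gcd : ∀ m n → ∃[ u ] ∃[ v ] u * a m + v * a n ≈ a (gcd m n))
    where

    -- The bound is independent of `n`: for n > 0, `D (suc n) n` runs over all divisors, `D n n`
    -- over the proper ones, and smaller bounds give the intermediate products of the induction. The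
    -- index 0 contributes 1, because 0 does not divide n.
    D : ℕ → ℕ → Carrier
    D k n = big k (λ d → when (d ∣? n) (b d))

    -- This is one stage of a strong induction on `n`, with `D≈a` as its hypothesis.
    module _ (n : ℕ) (D≈a : ∀ {m} → 0 < m → m < n → D (suc m) m ≈ a m) where

      private
        Dn≈a : ∀ {m} → 0 < m → m < n → D n m ≈ a m
        Dn≈a {m} 0<m m<n = trans
          (big-extend _ m<n λ d m<d → reflexive (when-no (d ∣? m) (<⇒∤ 0<m m<d)))
          (D≈a 0<m m<n)

        -- Among the factors `b d` of `a m`, those with d ∣ g multiply to `a g`, and `b m` is one of
        -- the remaining factors because m ∤ g.
        a-factor : ∀ {g m} → 0 < m → m < n → g ∣ m → m ∤ g → ∃[ r ] a m ≈ a g * (b m * r)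
        a-factor {g} {m} 0<m m<n g∣m m∤g = r , (begin
          a m                      ≈⟨ Dn≈a 0<m m<n ⟨
          D n m                    ≈⟨ big-split (_∣? m) (_∣? g) (λ _ d∣g → ∣-trans d∣g g∣m) n b ⟩
          D n g * big n rest       ≈⟨ *-cong (Dn≈a (∣⇒0< 0<m g∣m) g<n) (proj₂ factor) ⟩
          a g * (rest m * r)       ≈⟨ *-congˡ (*-congʳ rest-m) ⟩
          a g * (b m * r)          ∎)
          where
          rest : ℕ → Carrier
          rest d = when ((d ∣? m) ×-dec ¬? (d ∣? g)) (b d)

          rest-m : rest m ≈ b m
          rest-m = reflexive (when-yes ((m ∣? m) ×-dec ¬? (m ∣? g)) (∣-refl , m∤g))

          factor = big-factor rest m<n
          r = proj₁ factor
          g<n = ℕₚ.≤-<-trans (∣⇒≤ {{>-nonZero 0<m}} g∣m) m<n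

        -- Neither e nor k divides g = gcd e k, so `a e` and `a k` are `a g` times multiples of
        -- `b e` and `b k`. Cancelling the regular `a g` from the Bézout relation leaves 1.
        comaximal : ∀ {e k} → 0 < e → e < n → 0 < k → k < n → e ∤ k → k ∤ e →
          Comaximal (b e) (b k)
        comaximal {e} {k} 0<e e<n 0<k k<n e∤k k∤e
          with a-factor 0<e e<n (gcd[m,n]∣m e k) (λ e∣g → e∤k (∣-trans e∣g (gcd[m,n]∣n e k)))
             | a-factor 0<k k<n (gcd[m,n]∣n e k) (λ k∣g → k∤e (∣-trans k∣g (gcd[m,n]∣m e k)))
             | a-gcd e k
        ... | r , a-e | s , a-k | u , v , bezout =
          u * r , v * s , regular-cancel (a-regular 0<g) (begin
            A * (u * r * b e + v * s * b k)
              ≈⟨ solve 7 (λ A u r x v s y → A :* (u :* r :* x :+ v :* s :* y) :=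
                   u :* (A :* (x :* r)) :+ v :* (A :* (y :* s))) refl A u r (b e) v s (b k) ⟩
            u * (A * (b e * r)) + v * (A * (b k * s))
              ≈⟨ +-cong (*-congˡ a-e) (*-congˡ a-k) ⟨
            u * a e + v * a k
              ≈⟨ bezout ⟩
            A
              ≈⟨ *-identityʳ A ⟨
            A * 1# ∎)
          where
          A = a (gcd e k)
          0<g = ∣⇒0< 0<e (gcd[m,n]∣m e k)

      -- The divisors k < n are added one at a time in increasing order: the earlier factors
      -- b e with e ∤ k are comaximal to b k, and those with e ∣ k are already in D k ∣ a k.
      properDivisors-∣ : 0 < n → ∀ k → k ≤ n → ∃[ w ] a n ≈ D k n * w
      properDivisors-∣ 0<n zero    _   = a n , sym (*-identityˡ (a n))
      properDivisors-∣ 0<n (suc k) k<n with properDivisors-∣ 0<n k (ℕₚ.<⇒≤ k<n) | k ∣? n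
      ... | w , a≈Dw | no _ = w , trans a≈Dw (*-congʳ (sym (*-identityʳ _)))
      ... | z , a≈Dz | yes k∣n with a-∣ k∣n | comaximal-big k others others-comaximal
        where
        others : ℕ → Carrier
        others d = when ((d ∣? n) ×-dec ¬? (d ∣? k)) (b d)

        others-comaximal : ∀ d → d < k → Comaximal (others d) (b k)
        others-comaximal d d<k with d ∣? n | d ∣? k
        ... | no _    | _      = comaximal-1
        ... | yes _   | yes _  = comaximal-1
        ... | yes d∣n | no d∤k =
          comaximal 0<d (ℕₚ.<-trans d<k k<n) (∣⇒0< 0<n k∣n) k<n d∤k (<⇒∤ 0<d d<k)
          where 0<d = ∣⇒0< 0<n d∣n
      ...   | y , a≈ay | u , v , uS+vb≈1 = u * y + v * z , (begin
        a n                              ≈⟨ a≈Dz ⟩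
        D k n * z                        ≈⟨ *-congˡ z≈ ⟩
        D k n * (b k * (u * y + v * z))  ≈⟨ *-assoc _ _ _ ⟨
        D k n * b k * (u * y + v * z)    ∎)
        where
        T = D k k
        S = big k (λ d → when ((d ∣? n) ×-dec ¬? (d ∣? k)) (b d))
        0<k = ∣⇒0< 0<n k∣n

        a≈Tb : a k ≈ T * b k
        a≈Tb = trans (sym (D≈a 0<k k<n)) (*-congˡ (reflexive (when-yes (k ∣? k) ∣-refl)))

        -- All divisors of k divide n, so D k n = T S and T S z = a n = a k y = T b k y. The factor
        -- T of the regular `a k` is itself regular and cancels.
        Sz≈by : S * z ≈ b k * y
        Sz≈by = regular-cancel (regular-factor a≈Tb (a-regular 0<k)) (begin
          T * (S * z)    ≈⟨ *-assoc _ _ _ ⟨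
          T * S * z      ≈⟨ *-congʳ (big-split (_∣? n) (_∣? k) (λ _ d∣k → ∣-trans d∣k k∣n) k b) ⟨
          D k n * z      ≈⟨ a≈Dz ⟨
          a n            ≈⟨ a≈ay ⟩
          a k * y        ≈⟨ *-congʳ a≈Tb ⟩
          T * b k * y    ≈⟨ *-assoc _ _ _ ⟩
          T * (b k * y)  ∎)

        -- Multiplying z by u S + v b k = 1 leaves only multiples of `b k`, since S z is one.
        z≈ : z ≈ b k * (u * y + v * z)
        z≈ = begin
          z                              ≈⟨ *-identityˡ z ⟨
          1# * z                         ≈⟨ *-congʳ uS+vb≈1 ⟨
          (u * S + v * b k) * z          ≈⟨ solve 5 (λ u S v b z → (u :* S :+ v :* b) :* z :=
                                              u :* (S :* z) :+ v :* (b :* z)) refl u S v (b k) z ⟩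
          u * (S * z) + v * (b k * z)    ≈⟨ +-congʳ (*-congˡ Sz≈by) ⟩
          u * (b k * y) + v * (b k * z)  ≈⟨ solve 5 (λ u b y v z → u :* (b :* y) :+ v :* (b :* z) :=
                                              b :* (u :* y :+ v :* z)) refl u (b k) y v z ⟩
          b k * (u * y + v * z)          ∎

-- Division by monic polynomials

module Degree (R : CommutativeRing c ℓ) where
  open CommutativeRing R
  open Polynomials R
  open SetoidReasoning setoid

  -- Degree less than m, stated through coefficients because trailing zeros make the length of a
  -- list meaningless; the zero polynomial satisfies it for every m.
  Below : ℕ → Poly → Set _
  Below m f = ∀ i → m ≤ i → coeff f i ≈ 0#

  Monic : ℕ → Poly → Set _
  Monic m f = coeff f m ≈ 1# × Below (suc m) f

  private
    coeff-⊗-zero : ∀ a f g → coeff ((a ∷ f) ⊗ g) 0 ≈ a * coeff g 0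
    coeff-⊗-zero a f g = begin
      coeff (a • g ⊕ (0# ∷ f ⊗ g)) 0   ≈⟨ coeff-⊕ (a • g) (0# ∷ f ⊗ g) 0 ⟩
      coeff (a • g) 0 + 0#             ≈⟨ +-identityʳ _ ⟩
      coeff (a • g) 0                  ≈⟨ coeff-• a g 0 ⟩
      a * coeff g 0                    ∎

    coeff-⊗-suc : ∀ a f g i → coeff ((a ∷ f) ⊗ g) (suc i) ≈ a * coeff g (suc i) + coeff (f ⊗ g) i
    coeff-⊗-suc a f g i = begin
      coeff (a • g ⊕ (0# ∷ f ⊗ g)) (suc i)         ≈⟨ coeff-⊕ (a • g) (0# ∷ f ⊗ g) (suc i) ⟩
      coeff (a • g) (suc i) + coeff (f ⊗ g) i      ≈⟨ +-congʳ (coeff-• a g (suc i)) ⟩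
      a * coeff g (suc i) + coeff (f ⊗ g) i        ∎

    constant-tail : ∀ {a f} → Below 1 (a ∷ f) → ∀ g i → coeff (f ⊗ g) i ≈ 0#
    constant-tail {f = f} f<1 g =
      at (⊗-cong {f} {[]} {g} {g} (mk≋ λ i → f<1 (suc i) z<s) (mk≋ λ _ → refl))

    *-zeroʳ : ∀ {a b} → b ≈ 0# → a * b ≈ 0#
    *-zeroʳ {a} b≈0 = trans (*-congˡ b≈0) (zeroʳ a)

    0+0 : ∀ {a b} → a ≈ 0# → b ≈ 0# → a + b ≈ 0#
    0+0 a≈0 b≈0 = trans (+-cong a≈0 b≈0) (+-identityˡ 0#)

  -- The bounds carry a `suc`, so they say degree at most k and at most m, and such bounds add up
  -- without truncated subtraction.
  ⊗-Below : ∀ {k m} f g → Below (suc k) f → Below (suc m) g → Below (suc (k ℕ.+ m)) (f ⊗ g)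
  ⊗-Below []      g _ _ i _ = refl
  ⊗-Below {zero}  (a ∷ f) g f<1 g<m (suc i) (s≤s m≤i) = trans (coeff-⊗-suc a f g i)
    (0+0 (*-zeroʳ (g<m (suc i) (s≤s m≤i))) (constant-tail f<1 g i))
  ⊗-Below {suc k} {m} (a ∷ f) g f<k g<m (suc i) (s≤s k+m<i) = trans (coeff-⊗-suc a f g i)
    (0+0 (*-zeroʳ (g<m (suc i) (s≤s (ℕₚ.≤-trans (ℕₚ.m≤n+m m (suc k)) k+m<i))))
         (⊗-Below {k} {m} f g (λ j k<j → f<k (suc j) (s≤s k<j)) g<m i k+m<i))

  ⊗-leading : ∀ {k m} f g → Below (suc k) f → Below (suc m) g →
    coeff (f ⊗ g) (k ℕ.+ m) ≈ coeff f k * coeff g m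
  ⊗-leading []                     g _   _   = sym (zeroˡ _)
  ⊗-leading {zero}  {zero}  (a ∷ f) g _   _   = coeff-⊗-zero a f g
  ⊗-leading {zero}  {suc m} (a ∷ f) g f<1 _   = trans (coeff-⊗-suc a f g m)
    (trans (+-congˡ (constant-tail f<1 g m)) (+-identityʳ _))
  ⊗-leading {suc k} {m}     (a ∷ f) g f<k g<m = trans (coeff-⊗-suc a f g (k ℕ.+ m))
    (trans (+-cong (*-zeroʳ (g<m _ (s≤s (ℕₚ.m≤n+m m k))))
                   (⊗-leading {k} {m} f g (λ j k<j → f<k (suc j) (s≤s k<j)) g<m))
           (+-identityˡ _))

  Below-cong : ∀ {m f g} → f ≋ g → Below m f → Below m g
  Below-cong f≋g f<m i m≤i = trans (sym (at f≋g i)) (f<m i m≤i)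

  Monic-cong : ∀ {m f g} → f ≋ g → Monic m f → Monic m g
  Monic-cong {m} {f} f≋g (lead , f<) = trans (sym (at f≋g m)) lead , Below-cong {f = f} f≋g f<

  Monic-⊗ : ∀ {k m} f g → Monic k f → Monic m g → Monic (k ℕ.+ m) (f ⊗ g)
  Monic-⊗ f g (f₁ , f<) (g₁ , g<) =
    trans (⊗-leading f g f< g<) (trans (*-cong f₁ g₁) (*-identityˡ 1#)) , ⊗-Below f g f< g<

  Monic-1 : Monic 0 (const 1#)
  Monic-1 = refl , λ { (suc i) _ → refl }

module IntegerPolynomials where
  open Cyclotomic
  open Polynomials ℤ-ring
  open Degree ℤ-ring
  module ℤ[X] = CommutativeRing (ℤ-ring [X])
  open Regularity (ℤ-ring [X])
  open CommutativeRingSolver (ℤ-ring [X])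
  open RingProperties ℤ[X].ring using (x∙y⁻¹≈ε⇒x≈y)
  open SetoidReasoning ℤ[X].setoid

  -- Equality in ℤ is decidable, so trailing zeros can be recognised and skipped.
  zero-or-leading : ∀ f → f ≋ [] ⊎ ∃[ k ] coeff f k ≢ 0ℤ × Below (suc k) f
  zero-or-leading [] = inj₁ ℤ[X].refl
  zero-or-leading (a ∷ f) with zero-or-leading f | a ℤₚ.≟ 0ℤ
  ... | inj₂ (k , f≢0 , f<) | _       = inj₂ (suc k , f≢0 , λ { (suc i) (s≤s k<i) → f< i k<i })
  ... | inj₁ f≋[]           | yes a≡0 = inj₁ (mk≋ λ { zero → a≡0 ; (suc i) → at f≋[] i })
  ... | inj₁ f≋[]           | no a≢0  = inj₂ (0 , a≢0 , λ { (suc i) _ → at f≋[] i })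

  ⊗-monic-leading : ∀ {k m} f {g} → Below (suc k) f → Monic m g → coeff (f ⊗ g) (k ℕ.+ m) ≡ coeff f k
  ⊗-monic-leading f {g} f< (g₁ , g<) =
    ≡.trans (⊗-leading f g f< g<) (≡.trans (≡.cong (coeff f _ ℤ.*_) g₁) (ℤₚ.*-identityʳ _))

  -- A leading coefficient of h at k would reappear in the product at k + m, which is at least m.
  -- Both the regularity of monic polynomials and the uniqueness of quotients come from this.
  Below-⊗-monic : ∀ {m h g} → Monic m g → Below m (h ⊗ g) → h ≋ []
  Below-⊗-monic {m} {h} g-monic hg<m with zero-or-leading h
  ... | inj₁ h≋[] = h≋[]
  ... | inj₂ (k , h≢0 , h<) = contradiction
    (≡.trans (≡.sym (⊗-monic-leading h h< g-monic)) (hg<m (k ℕ.+ m) (ℕₚ.m≤n+m m k))) h≢0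

  Monic-regular : ∀ {m g} → Monic m g → Regular g
  Monic-regular {g = g} g-monic {h} gh≋[] =
    Below-⊗-monic {h = h} g-monic λ i _ → at (ℤ[X].trans (ℤ[X].*-comm h g) gh≋[]) i

  -- The last nonzero coefficient of q, at l, is also that of the product, at l + m. Comparison with
  -- f forces l + m = k and makes this coefficient 1. Applied below to show that `Φ n` is monic.
  Monic-cancel : ∀ {k m f} q g → Monic k f → Monic m g → f ≋ q ⊗ g → ∃[ l ] Monic l q
  Monic-cancel {k} {m} q g (f₁ , f<) g-monic f≋qg with zero-or-leading q
  ... | inj₁ q≋[] = contradiction
    (≡.trans (≡.sym f₁) (at (ℤ[X].trans f≋qg (⊗-cong {g = g} q≋[] ℤ[X].refl)) k)) λ ()
  ... | inj₂ (l , q≢0 , q<) with ℕₚ.<-cmp (l ℕ.+ m) k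
  ...   | tri< l+m<k _ _ = contradiction
    (≡.trans (≡.sym f₁) (≡.trans (at f≋qg k) (⊗-Below q g q< (proj₂ g-monic) k l+m<k))) λ ()
  ...   | tri> _ _ k<l+m = contradiction
    (≡.trans (≡.sym (⊗-monic-leading q q< g-monic)) (≡.trans (≡.sym (at f≋qg _)) (f< _ k<l+m))) q≢0
  ...   | tri≈ _ ≡.refl _ =
    l , ≡.trans (≡.sym (⊗-monic-leading q q< g-monic)) (≡.trans (≡.sym (at f≋qg _)) f₁) , q<

  -- `divMod` hands the computed `degree g` to `divStep`, whose invariant requires it to be the
  -- index of the leading 1.
  degree-Monic : ∀ {m} g → Monic m g → degree g ≡ m
  degree-Monic []      (() , _)
  degree-Monic {zero} (a ∷ g) (_ , g<) with all? (ℤₚ._≟ 0ℤ) g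
  ... | yes _  = ≡.refl
  ... | no ¬0 = contradiction (zeros g λ i → g< (suc i) z<s) ¬0
    where
    zeros : ∀ f → (∀ i → coeff f i ≡ 0ℤ) → All (_≡ 0ℤ) f
    zeros []      _   = []
    zeros (b ∷ f) f≡0 = f≡0 0 ∷ zeros f (f≡0 ∘ suc)
  degree-Monic {suc m} (a ∷ g) (g₁ , g<) with all? (ℤₚ._≟ 0ℤ) g
  ... | yes g≡0 = contradiction (≡.trans (≡.sym g₁) (coeff-zeros g≡0 m)) λ ()
    where
    coeff-zeros : ∀ {f} → All (_≡ 0ℤ) f → ∀ i → coeff f i ≡ 0ℤ
    coeff-zeros []          i       = ≡.refl
    coeff-zeros (b≡0 ∷ f≡0) zero    = b≡0
    coeff-zeros (b≡0 ∷ f≡0) (suc i) = coeff-zeros f≡0 i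
  ... | no _ = ≡.cong suc (degree-Monic g (g₁ , λ i m<i → g< (suc i) (s≤s m<i)))

  -- Induction from the highest coefficient down: a + X r has degree at most m, and subtracting t g
  -- clears its coefficient at m because g is monic.
  foldr-divStep : ∀ {m g} → Monic m g → ∀ f →
    let q , r = foldr (divStep m g) ([] , []) f in f ≋ q ⊗ g ⊕ r × Below m r
  foldr-divStep g-monic [] = ℤ[X].refl , λ _ _ → ≡.refl
  foldr-divStep {m} {g} g-monic@(g₁ , g<) (a ∷ f)
    with foldr (divStep m g) ([] , []) f | foldr-divStep {m} {g} g-monic f
  ... | q , r | f≋qg+r , r<m = division , r′<m
    where
    t = coeff (a ∷ r) m

    division : a ∷ f ≋ (t • g ⊕ (0ℤ ∷ q ⊗ g)) ⊕ ((a ∷ r) ⊕ ⊝ (t • g))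
    division = begin
      a ∷ f
        ≈⟨ ∷-cong (≡.sym (ℤₚ.+-identityˡ a)) f≋qg+r ⟩
      (0ℤ ∷ q ⊗ g) ⊕ (a ∷ r)
        ≈⟨ solve 3 (λ x y z → x :+ y := (z :+ x) :+ (y :- z)) ℤ[X].refl (0ℤ ∷ q ⊗ g) (a ∷ r) (t • g) ⟩
      (t • g ⊕ (0ℤ ∷ q ⊗ g)) ⊕ ((a ∷ r) ⊕ ⊝ (t • g)) ∎

    coeff-r′ : ∀ i → coeff ((a ∷ r) ⊕ ⊝ (t • g)) i ≡ coeff (a ∷ r) i ℤ.- t ℤ.* coeff g i
    coeff-r′ i = ≡.trans (coeff-⊕ (a ∷ r) (⊝ (t • g)) i) (≡.cong (ℤ._+_ (coeff (a ∷ r) i))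
      (≡.trans (coeff-⊝ (t • g) i) (≡.cong ℤ.-_ (coeff-• t g i))))

    r′<m : Below m ((a ∷ r) ⊕ ⊝ (t • g))
    r′<m i m≤i with ℕₚ.m≤n⇒m<n∨m≡n m≤i
    ... | inj₂ ≡.refl = ≡.trans (coeff-r′ i)
      (≡.trans (≡.cong (λ x → t ℤ.- t ℤ.* x) g₁)
        (≡.trans (≡.cong (ℤ._-_ t) (ℤₚ.*-identityʳ t)) (ℤₚ.+-inverseʳ t)))
    r′<m (suc i) _ | inj₁ (s≤s m≤i) = ≡.trans (coeff-r′ (suc i))
      (≡.cong₂ ℤ._-_ (r<m i m≤i) (≡.trans (≡.cong (ℤ._*_ t) (g< (suc i) (s≤s m≤i))) (ℤₚ.*-zeroʳ t)))

  -- From q g = q′ g + r it follows that (q - q′) g = r has degree below m, so q and the computed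
  -- quotient q′ agree.
  divMod-exact : ∀ {m f g} q → Monic m g → f ≋ q ⊗ g → f ≋ proj₁ (divMod f g) ⊗ g
  divMod-exact {m} {f} {g} q g-monic f≋qg rewrite degree-Monic g g-monic
    with foldr (divStep m g) ([] , []) f | foldr-divStep {m} {g} g-monic f
  ... | q′ , r | f≋q′g+r , r<m = begin
    f        ≈⟨ f≋qg ⟩
    q ⊗ g    ≈⟨ ⊗-cong {g = g} q≋q′ ℤ[X].refl ⟩
    q′ ⊗ g   ∎
    where
    q≋q′ : q ≋ q′
    q≋q′ = x∙y⁻¹≈ε⇒x≈y q q′ (Below-⊗-monic {h = q ⊕ ⊝ q′} g-monic (Below-cong {f = r} (begin
      r                              ≈⟨ solve 2 (λ r x → r := x :+ r :- x) ℤ[X].refl r (q′ ⊗ g) ⟩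
      (q′ ⊗ g ⊕ r) ⊕ ⊝ (q′ ⊗ g)      ≈⟨ ℤ[X].+-congʳ {x = ⊝ (q′ ⊗ g)} (ℤ[X].trans (ℤ[X].sym f≋q′g+r) f≋qg) ⟩
      q ⊗ g ⊕ ⊝ (q′ ⊗ g)             ≈⟨ solve 3 (λ x y z → x :* z :- y :* z := (x :- y) :* z)
                                          ℤ[X].refl q q′ g ⟩
      (q ⊕ ⊝ q′) ⊗ g                 ∎) r<m))

-- The factorisation of Xⁿ - 1

module PowersMinusOne (R : CommutativeRing c ℓ) (x : CommutativeRing.Carrier R) where
  open CommutativeRing R
  open CommutativeRingSolver R
  open SemiringExp semiring using (_^_; ^-homo-*)
  open SetoidReasoning setoid

  xⁿ-1 : ℕ → Carrier
  xⁿ-1 n = x ^ n - 1#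

  xᵐ⁺ⁿ-1 : ∀ m n → xⁿ-1 (m ℕ.+ n) ≈ xⁿ-1 m * x ^ n + xⁿ-1 n
  xᵐ⁺ⁿ-1 m n = begin
    x ^ (m ℕ.+ n) - 1#
      ≈⟨ +-congʳ (^-homo-* x m n) ⟩
    x ^ m * x ^ n - 1#
      ≈⟨ solve 3 (λ a b o → a :* b :- o := (a :* b :- b) :+ (b :- o)) refl (x ^ m) (x ^ n) 1# ⟩
    (x ^ m * x ^ n - x ^ n) + (x ^ n - 1#)
      -- The solver treats `1#` as a variable, so the factor `1#` has to be inserted by hand.
      ≈⟨ +-congʳ (+-congˡ (-‿cong (*-identityˡ (x ^ n)))) ⟨
    (x ^ m * x ^ n - 1# * x ^ n) + (x ^ n - 1#)
      ≈⟨ solve 3 (λ a b o → (a :* b :- o :* b) :+ (b :- o) := (a :- o) :* b :+ (b :- o)) refl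
           (x ^ m) (x ^ n) 1# ⟩
    (x ^ m - 1#) * x ^ n + (x ^ n - 1#) ∎

  -- The cofactor built by the recursion is the geometric sum of the powers of x ^ d.
  xⁿ-1-∣ : ∀ {d n} → d ∣ n → ∃[ y ] xⁿ-1 n ≈ xⁿ-1 d * y
  xⁿ-1-∣ {d} (divides q ≡.refl) = multiple q
    where
    multiple : ∀ q → ∃[ y ] xⁿ-1 (q ℕ.* d) ≈ xⁿ-1 d * y
    multiple zero    = 0# , trans (-‿inverseʳ 1#) (sym (zeroʳ _))
    multiple (suc q) with multiple q
    ... | y , eq = x ^ (q ℕ.* d) + y , trans (xᵐ⁺ⁿ-1 d (q ℕ.* d))
      (trans (+-congˡ eq) (sym (distribˡ _ _ _)))

  private
    -- Since i m = j n + g, x^(i m) - 1 equals (x^(j n) - 1) x^g + (x^g - 1), where the left side is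
    -- a multiple of x^m - 1 and x^(j n) - 1 one of x^n - 1.
    xⁿ-1-bezout : ∀ {m n g} i j → g ℕ.+ j ℕ.* n ≡ i ℕ.* m →
      ∃[ u ] ∃[ v ] u * xⁿ-1 m + v * xⁿ-1 n ≈ xⁿ-1 g
    xⁿ-1-bezout {m} {n} {g} i j eq with xⁿ-1-∣ (divides {m} i ≡.refl) | xⁿ-1-∣ (divides {n} j ≡.refl)
    ... | y , a-im | z , a-jn = y , - (z * x ^ g) , (begin
      y * a m + - (z * x ^ g) * a n
        ≈⟨ solve 5 (λ y m z g n → y :* m :+ (:- (z :* g)) :* n := m :* y :- n :* z :* g) refl
             y (a m) z (x ^ g) (a n) ⟩
      a m * y - a n * z * x ^ g
        ≈⟨ +-cong a-im (-‿cong (*-congʳ a-jn)) ⟨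
      a (i ℕ.* m) - a (j ℕ.* n) * x ^ g
        ≡⟨ ≡.cong (λ k → a k - a (j ℕ.* n) * x ^ g) (≡.trans (ℕₚ.+-comm (j ℕ.* n) g) eq) ⟨
      a (j ℕ.* n ℕ.+ g) - a (j ℕ.* n) * x ^ g
        ≈⟨ +-congʳ (xᵐ⁺ⁿ-1 (j ℕ.* n) g) ⟩
      a (j ℕ.* n) * x ^ g + a g - a (j ℕ.* n) * x ^ g
        ≈⟨ solve 2 (λ b c → b :+ c :- b := c) refl (a (j ℕ.* n) * x ^ g) (a g) ⟩
      a g ∎)
      where a = xⁿ-1

    fromIdentity : ∀ {m n g} → Bézout.Identity g m n → ∃[ u ] ∃[ v ] u * xⁿ-1 m + v * xⁿ-1 n ≈ xⁿ-1 g
    fromIdentity (Bézout.+- i j eq) = xⁿ-1-bezout i j eq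
    fromIdentity (Bézout.-+ i j eq) =
      let u , v , bezout = xⁿ-1-bezout j i eq in v , u , trans (+-comm _ _) bezout

  xⁿ-1-gcd : ∀ m n → ∃[ u ] ∃[ v ] u * xⁿ-1 m + v * xⁿ-1 n ≈ xⁿ-1 (gcd m n)
  xⁿ-1-gcd m n = fromIdentity (Bézout.identity (gcd-GCD m n))

module CyclotomicFactorisation where
  open Cyclotomic
  open Polynomials ℤ-ring
  open Degree ℤ-ring
  open IntegerPolynomials
  open Regularity (ℤ-ring [X])
  open PowersMinusOne (ℤ-ring [X]) X
  open SemiringExp ℤ[X].semiring using (_^_)
  open BigOperator ℤ[X].*-commutativeMonoid
  open SetoidReasoning ℤ[X].setoid

  ∈-properDivisors : ∀ n → 0 < n → All (λ d → 0 < d × d < n) (properDivisors n)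
  ∈-properDivisors n 0<n = All.tabulate λ d∈ →
    let d∈upTo , d∣n = ∈-filter⁻ (_∣? n) d∈ in ∣⇒0< 0<n d∣n , ∈-upTo⁻ d∈upTo

  ∏-properDivisors-cong : ∀ {f g} n → 0 < n → (∀ {d} → 0 < d → d < n → f d ≡ g d) →
    ∏ (ℤ-ring [X]) (properDivisors n) f ≡ ∏ (ℤ-ring [X]) (properDivisors n) g
  ∏-properDivisors-cong n 0<n f≡g = ≡.cong (foldr _⊗_ (const 1ℤ)) (map-cong-local
    (All.map (λ (0<d , d<n) → f≡g 0<d d<n) (∈-properDivisors n 0<n)))

  -- Each unfolding spends one unit of fuel and lowers the index by at least one, so fuel that
  -- starts at n or more never reaches the default value.
  Φ-fuel-irrelevant : ∀ {j k n} → 0 < n → n ≤ j → n ≤ k → Φ-fuel j n ≡ Φ-fuel k n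
  Φ-fuel-irrelevant {suc j} {suc k} {n} 0<n n≤1+j n≤1+k =
    ≡.cong (λ g → proj₁ (divMod (Xⁿ-1 n) g)) (∏-properDivisors-cong n 0<n λ 0<d d<n →
      Φ-fuel-irrelevant 0<d (ℕₚ.≤-pred (ℕₚ.≤-trans d<n n≤1+j)) (ℕₚ.≤-pred (ℕₚ.≤-trans d<n n≤1+k)))
  Φ-fuel-irrelevant {zero}          0<n n≤0 _   = contradiction (ℕₚ.<-≤-trans 0<n n≤0) λ ()
  Φ-fuel-irrelevant {suc _} {zero}  0<n _   n≤0 = contradiction (ℕₚ.<-≤-trans 0<n n≤0) λ ()

  Φ-unfold : ∀ {n} → 0 < n → Φ n ≡ proj₁ (divMod (Xⁿ-1 n) (∏ (ℤ-ring [X]) (properDivisors n) Φ))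
  Φ-unfold {suc k} 0<n = ≡.cong (λ g → proj₁ (divMod (Xⁿ-1 (suc k)) g))
    (∏-properDivisors-cong (suc k) 0<n λ 0<d d<n →
      Φ-fuel-irrelevant 0<d (ℕₚ.≤-pred d<n) ℕₚ.≤-refl)

  X⊗ : ∀ f → X ⊗ f ≋ 0ℤ ∷ f
  X⊗ f = ℤ[X].trans (0∷-⊗ (const 1ℤ) f) (∷-cong ≡.refl (⊗-identityˡ f))

  Xⁿ : ∀ n → replicate n 0ℤ ++ 1ℤ ∷ [] ≋ X ^ n
  Xⁿ zero    = ℤ[X].refl
  Xⁿ (suc n) = ℤ[X].trans (∷-cong ≡.refl (Xⁿ n)) (ℤ[X].sym (X⊗ (X ^ n)))

  Xⁿ-1≋ : ∀ n → Xⁿ-1 n ≋ xⁿ-1 n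
  Xⁿ-1≋ zero    = ℤ[X].sym (ℤ[X].-‿inverseʳ (const 1ℤ))
  Xⁿ-1≋ (suc n) = begin
    ℤ.-1ℤ ∷ replicate n 0ℤ ++ 1ℤ ∷ []             ≈⟨ ∷-cong ≡.refl (⊕-identityʳ _) ⟨
    (0ℤ ∷ replicate n 0ℤ ++ 1ℤ ∷ []) ⊕ ⊝ const 1ℤ ≈⟨ ℤ[X].+-congʳ (Xⁿ (suc n)) ⟩
    xⁿ-1 (suc n) ∎

  Monic-Xⁿ-1 : ∀ {n} → 0 < n → Monic n (Xⁿ-1 n)
  Monic-Xⁿ-1 {suc n} _ = lead n , λ { (suc i) (s≤s n<i) → below n i n<i }
    where
    lead : ∀ n → coeff (replicate n 0ℤ ++ 1ℤ ∷ []) n ≡ 1ℤ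
    lead zero    = ≡.refl
    lead (suc n) = lead n

    below : ∀ n → Below (suc n) (replicate n 0ℤ ++ 1ℤ ∷ [])
    below zero    (suc i) _         = ≡.refl
    below (suc n) (suc i) (s≤s n<i) = below n i n<i

  Monic-big : ∀ n f → (∀ i → i < n → ∃[ m ] Monic m (f i)) → ∃[ m ] Monic m (big n f)
  Monic-big zero    _ _ = 0 , Monic-1
  Monic-big (suc n) f h with Monic-big n f (λ i i<n → h i (ℕₚ.m<n⇒m<1+n i<n)) | h n (ℕₚ.n<1+n n)
  ... | k , ∏-monic | m , f-monic = k ℕ.+ m , Monic-⊗ (big n f) (f n) ∏-monic f-monic

  xⁿ-1-regular : ∀ {n} → 0 < n → Regular (xⁿ-1 n)
  xⁿ-1-regular {n} 0<n = Monic-regular {g = xⁿ-1 n} (Monic-cong (Xⁿ-1≋ n) (Monic-Xⁿ-1 0<n))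

  open DivisorProducts xⁿ-1 Φ xⁿ-1-regular xⁿ-1-∣ xⁿ-1-gcd public

  private
    -- Monicity is carried through the induction because `divMod-exact` asks for a monic divisor,
    -- here the product of the earlier `Φ d`.
    IsFactorised : ℕ → Set
    IsFactorised n = 0 < n → D (suc n) n ≋ xⁿ-1 n × ∃[ m ] Monic m (Φ n)

    factorise : ∀ n → (∀ {m} → m < n → IsFactorised m) → IsFactorised n
    factorise n rec 0<n = (begin
      D n n ⊗ when (n ∣? n) (Φ n)   ≡⟨ ≡.cong (D n n ⊗_) (when-yes (n ∣? n) ∣-refl) ⟩
      D n n ⊗ Φ n                   ≈⟨ ℤ[X].*-comm (D n n) (Φ n) ⟩
      Φ n ⊗ D n n                   ≈⟨ ℤ[X].*-congˡ {x = Φ n} P≋D ⟨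
      Φ n ⊗ P                       ≈⟨ Xⁿ-1≋ΦP ⟨
      Xⁿ-1 n                        ≈⟨ Xⁿ-1≋ n ⟩
      xⁿ-1 n                        ∎) ,
      Monic-cancel (Φ n) P (Monic-Xⁿ-1 0<n) P-monic Xⁿ-1≋ΦP
      where
      P = ∏ (ℤ-ring [X]) (properDivisors n) Φ

      P≋D : P ≋ D n n
      P≋D = foldr-filter (_∣? n) Φ n

      D-monic : ∃[ m ] Monic m (D n n)
      D-monic = Monic-big n _ monic
        where
        monic : ∀ d → d < n → ∃[ m ] Monic m (when (d ∣? n) (Φ d))
        monic d d<n with d ∣? n
        ... | yes d∣n = proj₂ (rec d<n (∣⇒0< 0<n d∣n))
        ... | no _    = 0 , Monic-1

      P-monic : Monic (proj₁ D-monic) P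
      P-monic = Monic-cong (ℤ[X].sym P≋D) (proj₂ D-monic)

      Xⁿ-1≋ΦP : Xⁿ-1 n ≋ Φ n ⊗ P
      -- With the bound k = n all proper divisors have been split off. The cofactor `w` is only
      -- known to exist; `divMod-exact` replaces it by the computed quotient, which is `Φ n`.
      Xⁿ-1≋ΦP with properDivisors-∣ n (λ 0<m m<n → proj₁ (rec m<n 0<m)) 0<n n ℕₚ.≤-refl
      ... | w , xⁿ-1≋Dw = ℤ[X].trans
        (divMod-exact {f = Xⁿ-1 n} {g = P} w P-monic (begin
          Xⁿ-1 n      ≈⟨ Xⁿ-1≋ n ⟩
          xⁿ-1 n      ≈⟨ xⁿ-1≋Dw ⟩
          D n n ⊗ w   ≈⟨ ℤ[X].*-comm (D n n) w ⟩
          w ⊗ D n n   ≈⟨ ℤ[X].*-congˡ {x = w} P≋D ⟨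
          w ⊗ P       ∎))
        (ℤ[X].reflexive (≡.cong (_⊗ P) (≡.sym (Φ-unfold 0<n))))

  ∏Φ≋Xⁿ-1 : ∀ {n} → 0 < n → D (suc n) n ≋ xⁿ-1 n
  ∏Φ≋Xⁿ-1 {n} 0<n = proj₁ (<-rec IsFactorised factorise n 0<n)

-- Gauss's argument for ∑ φ d = n: for d ∣ n, φ d counts the k in 1..n with gcd k n = n / d.
module TotientSum where
  open BigOperator ℕₚ.+-0-commutativeMonoid
  open ≡.≡-Reasoning

  φ-big : ∀ n → φ n ≡ big n (λ i → when (coprime? (suc i) n) 1)
  φ-big n = begin
    length (filter P? (map suc (upTo n)))                       ≡⟨ length-filter-map (upTo n) ⟩
    foldr ℕ._+_ 0 (map (λ _ → 1) (filter (P? ∘ suc) (upTo n)))  ≡⟨ foldr-filter (P? ∘ suc) (λ _ → 1) n ⟩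
    big n (λ i → when (P? (suc i)) 1)                           ∎
    where
    P? = λ k → coprime? k n

    length-filter-map : ∀ xs →
      length (filter P? (map suc xs)) ≡ foldr ℕ._+_ 0 (map (λ _ → 1) (filter (P? ∘ suc) xs))
    length-filter-map []       = ≡.refl
    length-filter-map (x ∷ xs) with does (P? (suc x))
    ... | true  = ≡.cong suc (length-filter-map xs)
    ... | false = length-filter-map xs

  -- The range 1..d e consists of d blocks of length e, each with its only multiple of e in last
  -- place; the induction removes the top block.
  big-multiples : ∀ {e} → 0 < e → ∀ f → (∀ k → e ∤ k → f k ≡ 0) → ∀ d →
    big (d ℕ.* e) (f ∘ suc) ≡ big d (λ j → f (suc j ℕ.* e))
  big-multiples         _   f _   zero    = ≡.refl
  big-multiples {suc e} 0<e f f≡0 (suc d) = begin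
    big (suc e ℕ.+ d ℕ.* suc e) (f ∘ suc)
      ≡⟨ big-+ (d ℕ.* suc e) (suc e) (f ∘ suc) ⟩
    big (d ℕ.* suc e) (f ∘ suc) ℕ.+ big (suc e) (λ i → f (suc (i ℕ.+ d ℕ.* suc e)))
      ≡⟨ ≡.cong₂ ℕ._+_ (big-multiples 0<e f f≡0 d)
           (big-single {e} (λ i → f (suc (i ℕ.+ d ℕ.* suc e))) (ℕₚ.n<1+n e) nonmultiple) ⟩
    big (suc d) (λ j → f (suc j ℕ.* suc e)) ∎
    where
    nonmultiple : ∀ i → i < suc e → i ≢ e → f (suc (i ℕ.+ d ℕ.* suc e)) ≡ 0
    nonmultiple i i≤e i≢e = f≡0 _ λ e∣ →
      <⇒∤ z<s (s≤s (ℕₚ.≤∧≢⇒< (ℕₚ.≤-pred i≤e) i≢e)) 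
        (∣m+n∣m⇒∣n (≡.subst (suc e ∣_) (ℕₚ.+-comm (suc i) (d ℕ.* suc e)) e∣) (n∣m*n d))

  -- With n = e d, only multiples of e can satisfy gcd k n = e, and gcd (j e) (e d) = e gcd j d
  -- reduces the condition on k = j e to j being coprime to d. The product form gcd k n * d = n
  -- avoids division and makes sense for every d.
  φ-gcd : ∀ {d n} → 0 < n → d ∣ n → φ d ≡ big n (λ i → when (gcd (suc i) n ℕ.* d ℕₚ.≟ n) 1)
  φ-gcd {d} {n} 0<n (divides e n≡ed) = begin
    φ d
      ≡⟨ φ-big d ⟩
    big d (λ j → when (coprime? (suc j) d) 1)
      ≡⟨ big-cong d (λ j _ → when-⇔ (coprime? (suc j) d) (gcd (suc j ℕ.* e) n ℕ.* d ℕₚ.≟ n)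
           (λ cop → to j cop) (λ eq → from j eq) 1) ⟩
    big d (λ j → f (suc j ℕ.* e))
      ≡⟨ big-multiples 0<e f f≡0 d ⟨
    big (d ℕ.* e) (f ∘ suc)
      ≡⟨ ≡.cong (λ m → big m (f ∘ suc)) (≡.trans n≡ed (ℕₚ.*-comm e d)) ⟨
    big n (f ∘ suc) ∎
    where
    f : ℕ → ℕ
    f k = when (gcd k n ℕ.* d ℕₚ.≟ n) 1

    0<e : 0 < e
    0<e = ∣⇒0< 0<n (divides d (≡.trans n≡ed (ℕₚ.*-comm e d)))

    0<d : 0 < d
    0<d = ∣⇒0< 0<n (divides e n≡ed)

    gcd·d≡n⇒gcd≡e : ∀ {g} → g ℕ.* d ≡ n → g ≡ e
    gcd·d≡n⇒gcd≡e {g} gd≡n = ℕₚ.*-cancelʳ-≡ g e d {{>-nonZero 0<d}} (≡.trans gd≡n n≡ed)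

    f≡0 : ∀ k → e ∤ k → f k ≡ 0
    f≡0 k e∤k = when-no (gcd k n ℕ.* d ℕₚ.≟ n) λ gd≡n →
      e∤k (≡.subst (_∣ k) (gcd·d≡n⇒gcd≡e gd≡n) (gcd[m,n]∣m k n))

    gcd-scale : ∀ j → gcd (suc j ℕ.* e) n ≡ e ℕ.* gcd (suc j) d
    gcd-scale j = begin
      gcd (suc j ℕ.* e) n            ≡⟨ ≡.cong₂ gcd (ℕₚ.*-comm (suc j) e) n≡ed ⟩
      gcd (e ℕ.* suc j) (e ℕ.* d)    ≡⟨ c*gcd[m,n]≡gcd[cm,cn] e (suc j) d ⟨
      e ℕ.* gcd (suc j) d            ∎

    to : ∀ j → Coprime (suc j) d → gcd (suc j ℕ.* e) n ℕ.* d ≡ n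
    to j coprime = begin
      gcd (suc j ℕ.* e) n ℕ.* d      ≡⟨ ≡.cong (ℕ._* d) (gcd-scale j) ⟩
      e ℕ.* gcd (suc j) d ℕ.* d      ≡⟨ ≡.cong (λ g → e ℕ.* g ℕ.* d) (coprime⇒gcd≡1 coprime) ⟩
      e ℕ.* 1 ℕ.* d                  ≡⟨ ≡.cong (ℕ._* d) (ℕₚ.*-identityʳ e) ⟩
      e ℕ.* d                        ≡⟨ n≡ed ⟨
      n                              ∎

    from : ∀ j → gcd (suc j ℕ.* e) n ℕ.* d ≡ n → Coprime (suc j) d
    from j gd≡n = gcd≡1⇒coprime (ℕₚ.*-cancelˡ-≡ _ 1 e {{>-nonZero 0<e}} (begin
      e ℕ.* gcd (suc j) d            ≡⟨ gcd-scale j ⟨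
      gcd (suc j ℕ.* e) n            ≡⟨ gcd·d≡n⇒gcd≡e gd≡n ⟩
      e                              ≡⟨ ℕₚ.*-identityʳ e ⟨
      e ℕ.* 1                        ∎))

  -- Double counting with the 0-1 matrix `F`: row d sums to φ d if d ∣ n and to 0 otherwise, and
  -- each column has a single 1, at the cofactor of the gcd.
  ∑φ≡n : ∀ {n} → 0 < n → big (suc n) (λ d → when (d ∣? n) (φ d)) ≡ n
  ∑φ≡n {n} 0<n = begin
    big (suc n) (λ d → when (d ∣? n) (φ d))
      ≡⟨ big-cong (suc n) (λ d _ → row d) ⟩
    big (suc n) (λ d → big n (λ i → F d i))
      ≡⟨ big-swap (suc n) n F ⟩
    big n (λ i → big (suc n) (λ d → F d i))
      ≡⟨ big-cong n (λ i _ → column i) ⟩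
    big n (λ _ → 1)
      ≡⟨ ones n ⟩
    n ∎
    where
    F : ℕ → ℕ → ℕ
    F d i = when (gcd (suc i) n ℕ.* d ℕₚ.≟ n) 1

    row : ∀ d → when (d ∣? n) (φ d) ≡ big n (F d)
    row d with d ∣? n
    ... | yes d∣n = φ-gcd 0<n d∣n
    ... | no  d∤n = ≡.sym (big-ε n λ i _ →
      when-no (gcd (suc i) n ℕ.* d ℕₚ.≟ n) λ gd≡n → d∤n (divides (gcd (suc i) n) (≡.sym gd≡n)))

    column : ∀ i → big (suc n) (λ d → F d i) ≡ 1
    column i with gcd[m,n]∣n (suc i) n
    ... | divides d n≡dg = ≡.trans
      (big-single (λ d → F d i) (s≤s (∣⇒≤ {{>-nonZero 0<n}} (divides (gcd (suc i) n) n≡gd)))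
        λ d′ _ d′≢d → when-no (gcd (suc i) n ℕ.* d′ ℕₚ.≟ n) λ gd′≡n →
          d′≢d (ℕₚ.*-cancelˡ-≡ d′ d _ {{>-nonZero (∣⇒0< 0<n (gcd[m,n]∣n (suc i) n))}}
            (≡.trans gd′≡n n≡gd)))
      (when-yes (gcd (suc i) n ℕ.* d ℕₚ.≟ n) (≡.sym n≡gd))
      where
      n≡gd : n ≡ gcd (suc i) n ℕ.* d
      n≡gd = ≡.trans n≡dg (ℕₚ.*-comm d _)

    ones : ∀ m → big m (λ _ → 1) ≡ m
    ones zero    = ≡.refl
    ones (suc m) = ≡.trans (≡.cong (ℕ._+ 1) (ones m)) (ℕₚ.+-comm m 1)

-- Ring homomorphisms and evaluation

RingHom : (R : CommutativeRing c ℓ) (S : CommutativeRing c′ ℓ′) →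
  (CommutativeRing.Carrier R → CommutativeRing.Carrier S) → Set _
RingHom R S = IsRingHomomorphism (CommutativeRing.rawRing R) (CommutativeRing.rawRing S)

module _ (R : CommutativeRing c ℓ) (S : CommutativeRing c′ ℓ′) where
  private
    module R = CommutativeRing R
    module S = CommutativeRing S

  ringHom : (h : R.Carrier → S.Carrier) →
    (∀ {x y} → x R.≈ y → h x S.≈ h y) →
    (∀ x y → h (x R.+ y) S.≈ h x S.+ h y) →
    (∀ x y → h (x R.* y) S.≈ h x S.* h y) →
    h R.0# S.≈ S.0# →
    h R.1# S.≈ S.1# →
    RingHom R S h
  ringHom h cong +-homo *-homo 0-homo 1-homo = record
    { isSemiringHomomorphism = record
      { isNearSemiringHomomorphism = record
        { +-isMonoidHomomorphism = record
          { isMagmaHomomorphism = record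
            { isRelHomomorphism = record { cong = cong }
            ; homo              = +-homo
            }
          ; ε-homo = 0-homo
          }
        ; *-homo = *-homo
        }
      ; 1#-homo = 1-homo
      }
    ; -‿homo = λ x → inverseˡ-unique _ _
        (S.trans (S.sym (+-homo (R.- x) x)) (S.trans (cong (R.-‿inverseˡ x)) 0-homo))
    }
    where open AbelianGroupProperties S.+-abelianGroup using (inverseˡ-unique)

  module BigProduct {h : R.Carrier → S.Carrier} (h-hom : RingHom R S h) where
    open IsRingHomomorphism h-hom
    open BigHomomorphism R.*-commutativeMonoid S.*-commutativeMonoid h *-isMonoidHomomorphism public

fromℤ-hom : (R : CommutativeRing c ℓ) → RingHom Cyclotomic.ℤ-ring R (fromℤ R)
fromℤ-hom R = ringHom Cyclotomic.ℤ-ring R (fromℤ R)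
  (λ i≡j → reflexive (≡.cong (fromℤ R) i≡j)) fromℤ-+ fromℤ-* refl fromℤ-1
  where
  open CommutativeRing R
  open FromℤHomomorphism R

const-hom : (R : CommutativeRing c ℓ) → RingHom R (R [X]) (Polynomials.const R)
const-hom R = ringHom R (R [X]) const
  (λ a≈b → ∷-cong a≈b R[X].refl)
  (λ _ _ → R[X].refl)
  (λ a b → ∷-cong (sym (+-identityʳ _)) R[X].refl)
  0∷[]
  R[X].refl
  where
  open CommutativeRing R
  open Polynomials R
  module R[X] = CommutativeRing (R [X])

module Evaluation (R : CommutativeRing c ℓ) (S : CommutativeRing c′ ℓ′)
  (h : CommutativeRing.Carrier R → CommutativeRing.Carrier S) (h-hom : RingHom R S h)
  (x : CommutativeRing.Carrier S) where
  private
    module R = CommutativeRing R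
    module h = IsRingHomomorphism h-hom
  open CommutativeRing S
  open Polynomials R
  open CommutativeRingSolver S
  open SetoidReasoning setoid

  -- Coefficients are first moved along `h`, so the same module evaluates integral polynomials at α
  -- / β and specialises B and C.
  evalAt : Poly → Carrier
  evalAt f = Polynomials.eval S (map h f) x

  private
    -- Equal polynomials may be lists of different lengths; this disposes of the surplus zeros of
    -- the longer one.
    evalAt-zero : ∀ f → f ≋ [] → evalAt f ≈ 0#
    evalAt-zero []      _ = refl
    evalAt-zero (a ∷ f) p = begin
      h a + x * evalAt f  ≈⟨ +-cong (trans (h.⟦⟧-cong (at p 0)) h.0#-homo)
                                    (*-congˡ (evalAt-zero f (mk≋ λ i → at p (suc i)))) ⟩
      0# + x * 0#         ≈⟨ +-identityˡ _ ⟩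
      x * 0#              ≈⟨ zeroʳ x ⟩
      0#                  ∎

    evalAt-cong : ∀ f g → f ≋ g → evalAt f ≈ evalAt g
    evalAt-cong []      g       p = sym (evalAt-zero g (mk≋ λ i → R.sym (at p i)))
    evalAt-cong (a ∷ f) []      p = evalAt-zero (a ∷ f) p
    evalAt-cong (a ∷ f) (b ∷ g) p =
      +-cong (h.⟦⟧-cong (at p 0)) (*-congˡ (evalAt-cong f g (mk≋ λ i → at p (suc i))))

    evalAt-⊕ : ∀ f g → evalAt (f ⊕ g) ≈ evalAt f + evalAt g
    evalAt-⊕ []      g       = sym (+-identityˡ _)
    evalAt-⊕ (a ∷ f) []      = sym (+-identityʳ _)
    evalAt-⊕ (a ∷ f) (b ∷ g) = begin
      h (a R.+ b) + x * evalAt (f ⊕ g)              ≈⟨ +-cong (h.+-homo a b) (*-congˡ (evalAt-⊕ f g)) ⟩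
      h a + h b + x * (evalAt f + evalAt g)
        ≈⟨ solve 5 (λ a b x f g → a :+ b :+ x :* (f :+ g) := a :+ x :* f :+ (b :+ x :* g)) refl
             (h a) (h b) x (evalAt f) (evalAt g) ⟩
      h a + x * evalAt f + (h b + x * evalAt g)     ∎

    evalAt-• : ∀ a f → evalAt (a • f) ≈ h a * evalAt f
    evalAt-• a []      = sym (zeroʳ _)
    evalAt-• a (b ∷ f) = begin
      h (a R.* b) + x * evalAt (a • f)    ≈⟨ +-cong (h.*-homo a b) (*-congˡ (evalAt-• a f)) ⟩
      h a * h b + x * (h a * evalAt f)
        ≈⟨ solve 4 (λ a b x f → a :* b :+ x :* (a :* f) := a :* (b :+ x :* f)) refl
             (h a) (h b) x (evalAt f) ⟩
      h a * (h b + x * evalAt f)          ∎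

    evalAt-⊗ : ∀ f g → evalAt (f ⊗ g) ≈ evalAt f * evalAt g
    evalAt-⊗ []      g = sym (zeroˡ _)
    evalAt-⊗ (a ∷ f) g = begin
      evalAt (a • g ⊕ (R.0# ∷ f ⊗ g))                  ≈⟨ evalAt-⊕ (a • g) (R.0# ∷ f ⊗ g) ⟩
      evalAt (a • g) + (h R.0# + x * evalAt (f ⊗ g))
        ≈⟨ +-cong (evalAt-• a g) (trans (+-congʳ h.0#-homo) (+-identityˡ _)) ⟩
      h a * evalAt g + x * evalAt (f ⊗ g)              ≈⟨ +-congˡ (*-congˡ (evalAt-⊗ f g)) ⟩
      h a * evalAt g + x * (evalAt f * evalAt g)
        ≈⟨ solve 4 (λ a x f g → a :* g :+ x :* (f :* g) := (a :+ x :* f) :* g) refl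
             (h a) x (evalAt f) (evalAt g) ⟩
      (h a + x * evalAt f) * evalAt g                  ∎

  evalAt-const : ∀ a → evalAt (const a) ≈ h a
  evalAt-const a = trans (+-congˡ (zeroʳ x)) (+-identityʳ _)

  evalAt-X : evalAt X ≈ x
  evalAt-X = begin
    h R.0# + x * evalAt (const R.1#)  ≈⟨ +-cong h.0#-homo (*-congˡ (trans (evalAt-const R.1#) h.1#-homo)) ⟩
    0# + x * 1#                       ≈⟨ +-identityˡ _ ⟩
    x * 1#                            ≈⟨ *-identityʳ x ⟩
    x                                 ∎

  evalAt-hom : RingHom (R [X]) S evalAt
  evalAt-hom = ringHom (R [X]) S evalAt
    (λ {f} {g} → evalAt-cong f g) evalAt-⊕ evalAt-⊗ refl
    (trans (evalAt-const R.1#) h.1#-homo)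

-- Cancellation and division in a field

module FieldProperties (F : Field c ℓ) where
  open Field F
  open Regularity commutativeRing
  open SetoidReasoning setoid

  ≉0⇒regular : ∀ {x} → x ≉ 0# → Regular x
  ≉0⇒regular {x} x≉0 {y} xy≈0 with inverse x x≉0
  ... | x⁻¹ , xx⁻¹≈1 = begin
    y                ≈⟨ *-identityˡ y ⟨
    1# * y           ≈⟨ *-congʳ (trans (*-comm x⁻¹ x) xx⁻¹≈1) ⟨
    x⁻¹ * x * y      ≈⟨ *-assoc _ _ _ ⟩
    x⁻¹ * (x * y)    ≈⟨ *-congˡ xy≈0 ⟩
    x⁻¹ * 0#         ≈⟨ zeroʳ _ ⟩
    0#               ∎

  *-cancel-/ : ∀ x {y} → y ≉ 0# → y * (x / y) ≈ x
  *-cancel-/ x {y} y≉0 with y ≟ 0#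
  ... | yes y≈0 = contradiction y≈0 y≉0
  ... | no y≉0′ with inverse y y≉0′
  ...   | y⁻¹ , yy⁻¹≈1 = begin
    y * (x * y⁻¹)    ≈⟨ *-congˡ (*-comm x y⁻¹) ⟩
    y * (y⁻¹ * x)    ≈⟨ *-assoc _ _ _ ⟨
    y * y⁻¹ * x      ≈⟨ *-congʳ yy⁻¹≈1 ⟩
    1# * x           ≈⟨ *-identityˡ x ⟩
    x                ∎

-- Specialisation of B and C

module Specialisation (F : Field c ℓ) where
  open Field F
  open LucasPolynomials F
  private
    module P = CommutativeRing F[B,C]
    id-hom = Identity.isRingHomomorphism rawRing refl
    module AtB = Evaluation commutativeRing commutativeRing id id-hom (- 1#)
    module AtC = Evaluation (commutativeRing [X]) commutativeRing AtB.evalAt AtB.evalAt-hom 0#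
  open RingProperties ring using (-0#≈0#)
  open AbelianGroupProperties +-abelianGroup using (⁻¹-involutive)
  open SetoidReasoning setoid

  -- The inner variable B goes to -1 and the outer variable C to 0. This turns T² + B T + C into T²
  -- - T, whose roots 1 and 0 differ in every characteristic.
  σ : P.Carrier → Carrier
  σ = AtC.evalAt

  open IsRingHomomorphism AtC.evalAt-hom public
    using ()
    renaming (⟦⟧-cong to σ-cong; +-homo to σ-+; *-homo to σ-*; -‿homo to σ-neg;
              0#-homo to σ-0; 1#-homo to σ-1)

  σ-B : σ B ≈ - 1#
  σ-B = trans (AtC.evalAt-const (Polynomials.X commutativeRing)) AtB.evalAt-X

  σ-C : σ C ≈ 0#
  σ-C = AtC.evalAt-X

  -- Under `σ` the recurrence says that each term equals the preceding one.
  σ-𝒰 : ∀ n → σ (𝒰 (suc n)) ≈ 1#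
  σ-𝒰 zero    = σ-1
  σ-𝒰 (suc n) = begin
    σ (P.- B P.* 𝒰 (suc n) P.- C P.* 𝒰 n)            ≈⟨ σ-+ (P.- B P.* 𝒰 (suc n)) (P.- (C P.* 𝒰 n)) ⟩
    σ (P.- B P.* 𝒰 (suc n)) + σ (P.- (C P.* 𝒰 n))    ≈⟨ +-cong (σ-* (P.- B) (𝒰 (suc n))) (σ-neg (C P.* 𝒰 n)) ⟩
    σ (P.- B) * σ (𝒰 (suc n)) - σ (C P.* 𝒰 n)        ≈⟨ +-cong
      (*-cong (trans (σ-neg B) (trans (-‿cong σ-B) (⁻¹-involutive 1#))) (σ-𝒰 n))
      (-‿cong (trans (σ-* C (𝒰 n)) (trans (*-congʳ σ-C) (zeroˡ _)))) ⟩
    1# * 1# - 0#                                     ≈⟨ +-cong (*-identityˡ 1#) -0#≈0# ⟩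
    1# + 0#                                          ≈⟨ +-identityʳ 1# ⟩
    1#                                               ∎

  𝒰≉0 : ∀ {n} → 0 < n → 𝒰 n P.≉ P.0#
  𝒰≉0 {suc n} _ 𝒰≈0 = 1≉0 (trans (sym (σ-𝒰 n)) (trans (σ-cong 𝒰≈0) σ-0))

  C≉0 : C P.≉ P.0#
  C≉0 C≈0 = 1≉0 (Polynomials.at (Polynomials.at C≈0 1) 0)

  B²≉4C : B P.* B P.≉ (C P.+ C) P.+ (C P.+ C)
  B²≉4C B²≈4C = 1≉0 (begin
    1#                              ≈⟨ *-identityˡ 1# ⟨
    1# * 1#                         ≈⟨ solve 1 (λ o → o :* o := (:- o) :* (:- o)) refl 1# ⟩
    - 1# * - 1#                     ≈⟨ *-cong σ-B σ-B ⟨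
    σ B * σ B                       ≈⟨ σ-* B B ⟨
    σ (B P.* B)                     ≈⟨ σ-cong B²≈4C ⟩
    σ ((C P.+ C) P.+ (C P.+ C))     ≈⟨ σ-+ (C P.+ C) (C P.+ C) ⟩
    σ (C P.+ C) + σ (C P.+ C)       ≈⟨ +-cong 2C 2C ⟩
    0# + 0#                         ≈⟨ +-identityˡ 0# ⟩
    0#                              ∎)
    where
    open CommutativeRingSolver commutativeRing
    2C : σ (C P.+ C) ≈ 0#
    2C = trans (σ-+ C C) (trans (+-cong σ-C σ-C) (+-identityˡ 0#))

-- Lucas sequences

module LucasFactorisation (F : Field c ℓ) (L : Field c′ ℓ′)
  (ι : CommutativeRing.Carrier (LucasPolynomials.F[B,C] F) → Field.Carrier L)
  (ι-mono : IsRingMonomorphism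
    (CommutativeRing.rawRing (LucasPolynomials.F[B,C] F)) (Field.rawRing L) ι)
  (α β : Field.Carrier L) (roots : LucasPolynomials.AreTheRoots F L ι α β)
  where
  open LucasPolynomials F
  private
    module F = Field F
    module P = CommutativeRing F[B,C]
    module ι = IsRingMonomorphism ι-mono
    module PolyOps = BigOperator P.*-commutativeMonoid
    module Cyc = CyclotomicFactorisation
  open Field L
  open CommutativeRingSolver commutativeRing
  open RingProperties ring using (x∙y⁻¹≈ε⇒x≈y)
  open Regularity commutativeRing
  open FieldProperties L
  open Specialisation F
  open BigOperator *-commutativeMonoid
  open CommutativeSemiringExp commutativeSemiring using (^-homo-*; ^-distrib-*; ^-congˡ; ^-congʳ)
  open SetoidReasoning setoid

  αβ≈C : α * β ≈ ι C
  αβ≈C = begin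
    α * β              ≈⟨ solve 2 (λ a b → a :* b := (:- a) :* (:- b)) refl α β ⟩
    - α * - β          ≈⟨ +-identityʳ _ ⟨
    - α * - β + 0#     ≈⟨ Polynomials.at roots 0 ⟨
    ι C                ∎

  α+β≈-B : α + β ≈ - ι B
  α+β≈-B = begin
    α + β                               ≈⟨ +-cong (*-identityʳ α) (*-identityˡ β) ⟨
    α * 1# + 1# * β                     ≈⟨ +-congˡ (+-identityʳ _) ⟨
    -- The shape aimed at is the coefficient of T in the product of the linear factors, as `⊗`
    -- computes it; `0#` and `1#` are again solver variables.
    α * 1# + (1# * β + 0#)              ≈⟨ solve 4 (λ a b o z → a :* o :+ (o :* b :+ z) :=
                                             :- ((:- a) :* o :+ (o :* (:- b) :- z))) refl α β 1# 0# ⟩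
    - (- α * 1# + (1# * - β - 0#))      ≈⟨ -‿cong (+-congˡ (+-congˡ -0#≈0#)) ⟩
    - (- α * 1# + (1# * - β + 0#))      ≈⟨ -‿cong (Polynomials.at roots 1) ⟨
    - ι B                               ∎
    where open RingProperties ring using (-0#≈0#)

  ι≈0⇒≈0 : ∀ {x} → ι x ≈ 0# → x P.≈ P.0#
  ι≈0⇒≈0 ιx≈0 = ι.injective (trans ιx≈0 (sym ι.0#-homo))

  β≉0 : β ≉ 0#
  β≉0 β≈0 = C≉0 (ι≈0⇒≈0 (trans (sym αβ≈C) (trans (*-congˡ β≈0) (zeroʳ α))))

  -- If α = β, then B² = (α + β)² = (α + α)(β + β) = 4 α β = 4 C, and injectivity of `ι` carries
  -- this back to F[B,C].
  α-β≉0 : α - β ≉ 0#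
  α-β≉0 α-β≈0 = B²≉4C (ι.injective (begin
    ι (B P.* B)                          ≈⟨ ι.*-homo B B ⟩
    ι B * ι B                            ≈⟨ solve 1 (λ b → b :* b := (:- b) :* (:- b)) refl (ι B) ⟩
    - ι B * - ι B                        ≈⟨ *-cong α+β≈-B α+β≈-B ⟨
    (α + β) * (α + β)                    ≈⟨ *-cong (+-congˡ (sym α≈β)) (+-congʳ α≈β) ⟩
    (α + α) * (β + β)                    ≈⟨ solve 2 (λ a b → (a :+ a) :* (b :+ b) :=
                                              (a :* b :+ a :* b) :+ (a :* b :+ a :* b)) refl α β ⟩
    (α * β + α * β) + (α * β + α * β)    ≈⟨ +-cong 2C 2C ⟩
    ι (C P.+ C) + ι (C P.+ C)            ≈⟨ ι.+-homo (C P.+ C) (C P.+ C) ⟨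
    ι ((C P.+ C) P.+ (C P.+ C))          ∎))
    where
    α≈β : α ≈ β
    α≈β = x∙y⁻¹≈ε⇒x≈y α β α-β≈0

    2C : α * β + α * β ≈ ι (C P.+ C)
    2C = trans (+-cong αβ≈C αβ≈C) (sym (ι.+-homo C C))

  private
    ι-recurrence : ∀ x y → ι (P.- B P.* x P.- C P.* y) ≈ (α + β) * ι x - α * β * ι y
    ι-recurrence x y = begin
      ι (P.- B P.* x P.- C P.* y)            ≈⟨ ι.+-homo (P.- B P.* x) (P.- (C P.* y)) ⟩
      ι (P.- B P.* x) + ι (P.- (C P.* y))    ≈⟨ +-cong (ι.*-homo (P.- B) x) (ι.-‿homo (C P.* y)) ⟩
      ι (P.- B) * ι x - ι (C P.* y)          ≈⟨ +-cong (*-congʳ (trans (ι.-‿homo B) (sym α+β≈-B)))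
                                                  (-‿cong (trans (ι.*-homo C y) (*-congʳ (sym αβ≈C)))) ⟩
      (α + β) * ι x - α * β * ι y            ∎

  -- Binet's formula with its denominator cleared; α and β satisfy the characteristic equation of
  -- the recurrence.
  ι-𝒰 : ∀ n → ι (𝒰 n) * (α - β) ≈ α ^ n - β ^ n
  ι-𝒰 zero       = trans (trans (*-congʳ ι.0#-homo) (zeroˡ _)) (sym (-‿inverseʳ 1#))
  ι-𝒰 (suc zero) = begin
    ι P.1# * (α - β)     ≈⟨ *-congʳ ι.1#-homo ⟩
    1# * (α - β)         ≈⟨ solve 3 (λ a b o → o :* (a :- b) := a :* o :- b :* o) refl α β 1# ⟩
    α * 1# - β * 1#      ∎
  ι-𝒰 (suc (suc n)) = begin
    ι (𝒰 (suc (suc n))) * (α - β)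
      ≈⟨ *-congʳ (ι-recurrence (𝒰 (suc n)) (𝒰 n)) ⟩
    ((α + β) * ι (𝒰 (suc n)) - α * β * ι (𝒰 n)) * (α - β)
      ≈⟨ solve 4 (λ a b u v → ((a :+ b) :* u :- a :* b :* v) :* (a :- b) :=
           (a :+ b) :* (u :* (a :- b)) :- a :* b :* (v :* (a :- b))) refl α β (ι (𝒰 (suc n))) (ι (𝒰 n)) ⟩
    (α + β) * (ι (𝒰 (suc n)) * (α - β)) - α * β * (ι (𝒰 n) * (α - β))
      ≈⟨ +-cong (*-congˡ (ι-𝒰 (suc n))) (-‿cong (*-congˡ (ι-𝒰 n))) ⟩
    (α + β) * (α * α ^ n - β * β ^ n) - α * β * (α ^ n - β ^ n)
      ≈⟨ solve 4 (λ a b x y → (a :+ b) :* (a :* x :- b :* y) :- a :* b :* (x :- y) :=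
           a :* (a :* x) :- b :* (b :* y)) refl α β (α ^ n) (β ^ n) ⟩
    α * (α * α ^ n) - β * (β * β ^ n) ∎

  ι-𝒱 : ∀ n → ι (𝒱 n) ≈ α ^ n + β ^ n
  ι-𝒱 zero       = trans (ι.+-homo P.1# P.1#) (+-cong ι.1#-homo ι.1#-homo)
  ι-𝒱 (suc zero) = begin
    ι (P.- B)            ≈⟨ ι.-‿homo B ⟩
    - ι B                ≈⟨ α+β≈-B ⟨
    α + β                ≈⟨ +-cong (*-identityʳ α) (*-identityʳ β) ⟨
    α * 1# + β * 1#      ∎
  ι-𝒱 (suc (suc n)) = begin
    ι (𝒱 (suc (suc n)))
      ≈⟨ ι-recurrence (𝒱 (suc n)) (𝒱 n) ⟩
    (α + β) * ι (𝒱 (suc n)) - α * β * ι (𝒱 n)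
      ≈⟨ +-cong (*-congˡ (ι-𝒱 (suc n))) (-‿cong (*-congˡ (ι-𝒱 n))) ⟩
    (α + β) * (α * α ^ n + β * β ^ n) - α * β * (α ^ n + β ^ n)
      ≈⟨ solve 4 (λ a b x y → (a :+ b) :* (a :* x :+ b :* y) :- a :* b :* (x :+ y) :=
           a :* (a :* x) :+ b :* (b :* y)) refl α β (α ^ n) (β ^ n) ⟩
    α * (α * α ^ n) + β * (β * β ^ n) ∎

  -- By `ι-𝒰` this is a product of two nonzero elements of a field.
  αⁿ-βⁿ-regular : ∀ {n} → 0 < n → Regular (α ^ n - β ^ n)
  αⁿ-βⁿ-regular {n} 0<n {y} p = ≉0⇒regular (λ ι𝒰≈0 → 𝒰≉0 0<n (ι≈0⇒≈0 ι𝒰≈0))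
    (≉0⇒regular α-β≉0 (begin
      (α - β) * (ι (𝒰 n) * y)    ≈⟨ solve 3 (λ d u y → d :* (u :* y) := u :* d :* y) refl
                                      (α - β) (ι (𝒰 n)) y ⟩
      ι (𝒰 n) * (α - β) * y      ≈⟨ *-congʳ (ι-𝒰 n) ⟩
      (α ^ n - β ^ n) * y        ≈⟨ p ⟩
      0#                         ∎))

  -- At d = 1 this is α - β, whereas `Λ 1` is 1; from d = 2 on it is the image of `Λ d`.
  Ψ : ℕ → Carrier
  Ψ d = Φʰᵒᵐ L ι d α β

  private
    -- Passing through F reduces integers modulo the characteristic, so the factorisation over ℤ
    -- carries over to L also when the characteristic divides n.
    h : ℤ → Carrier
    h = ι ∘ constant ∘ fromℤ F.commutativeRing

    h-hom : RingHom Cyclotomic.ℤ-ring commutativeRing h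
    h-hom = Composition.isRingHomomorphism trans
      (Composition.isRingHomomorphism P.trans
        (fromℤ-hom F.commutativeRing)
        (Composition.isRingHomomorphism P.trans
          (const-hom F.commutativeRing) (const-hom (F.commutativeRing [X]))))
      ι.isRingHomomorphism

    module AtRatio = Evaluation Cyclotomic.ℤ-ring commutativeRing h h-hom (α / β)
    open AtRatio using (evalAt; evalAt-hom; evalAt-X)
    module evalAt = IsRingHomomorphism evalAt-hom
    module ℤ[X] = CommutativeRing (Cyclotomic.ℤ-ring [X])
    open SemiringExp ℤ[X].semiring using () renaming (_^_ to _^ᴾ_)
    open Polynomials Cyclotomic.ℤ-ring using (X)
    open PowersMinusOne (Cyclotomic.ℤ-ring [X]) X using (xⁿ-1)

    Ψ≈ : ∀ d → Ψ d ≈ β ^ φ d * evalAt (Cyclotomic.Φ d)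
    Ψ≈ d = *-congˡ (reflexive (≡.cong (λ f → Polynomials.eval commutativeRing f (α / β))
      (≡.sym (map-∘ (Cyclotomic.Φ d)))))

    evalAt-X^ : ∀ n → evalAt (X ^ᴾ n) ≈ (α / β) ^ n
    evalAt-X^ zero    = evalAt.1#-homo
    evalAt-X^ (suc n) = trans (evalAt.*-homo X (X ^ᴾ n))
      (*-cong evalAt-X (evalAt-X^ n))

    evalAt-xⁿ-1 : ∀ n → evalAt (xⁿ-1 n) ≈ (α / β) ^ n - 1#
    evalAt-xⁿ-1 n = trans (evalAt.+-homo (X ^ᴾ n) (ℤ[X].- ℤ[X].1#))
      (+-cong (evalAt-X^ n) (trans (evalAt.-‿homo ℤ[X].1#) (-‿cong evalAt.1#-homo)))

  ∏Ψ≈αⁿ-βⁿ : ∀ {n} → 0 < n → big (suc n) (λ d → when (d ∣? n) (Ψ d)) ≈ α ^ n - β ^ n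
  ∏Ψ≈αⁿ-βⁿ {n} 0<n = begin
    big (suc n) (λ d → when (d ∣? n) (Ψ d))
      ≈⟨ big-cong (suc n) (λ d _ → trans (when-cong (d ∣? n) (λ _ → Ψ≈ d)) (when-∙ (d ∣? n) _ _)) ⟩
    big (suc n) (λ d → when (d ∣? n) (β ^ φ d) * when (d ∣? n) (evalAt (Cyclotomic.Φ d)))
      ≈⟨ big-∙ (suc n) _ _ ⟩
    big (suc n) (λ d → when (d ∣? n) (β ^ φ d)) * big (suc n) (λ d → when (d ∣? n) (evalAt (Cyclotomic.Φ d)))
      ≈⟨ *-cong powers values ⟩
    β ^ n * ((α / β) ^ n - 1#)
      ≈⟨ solve 3 (λ b x o → b :* (x :- o) := b :* x :- b :* o) refl (β ^ n) ((α / β) ^ n) 1# ⟩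
    β ^ n * (α / β) ^ n - β ^ n * 1#
      -- Here β (α / β) = α: since β is nonzero, the quotient is not the default value.
      ≈⟨ +-cong (trans (sym (^-distrib-* β (α / β) n)) (^-congˡ n (*-cancel-/ α β≉0)))
                (-‿cong (*-identityʳ (β ^ n))) ⟩
    α ^ n - β ^ n ∎
    where
    powers : big (suc n) (λ d → when (d ∣? n) (β ^ φ d)) ≈ β ^ n
    -- Exponentiation of β turns the sum of the φ d into a product of powers.
    powers = trans (sym (big-when-homo (_∣? n) (suc n) φ)) (^-congʳ β (TotientSum.∑φ≡n 0<n))
      where
      β^-hom : IsMonoidHomomorphism ℕ.+-0-rawMonoid *-rawMonoid (β ^_)
      β^-hom = record
        { isMagmaHomomorphism = record
          { isRelHomomorphism = record { cong = ^-congʳ β }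
          ; homo              = ^-homo-* β
          }
        ; ε-homo = refl
        }

      open BigHomomorphism ℕₚ.+-0-commutativeMonoid *-commutativeMonoid (β ^_) β^-hom

    values : big (suc n) (λ d → when (d ∣? n) (evalAt (Cyclotomic.Φ d))) ≈ (α / β) ^ n - 1#
    values = begin
      big (suc n) (λ d → when (d ∣? n) (evalAt (Cyclotomic.Φ d)))
        ≈⟨ big-when-homo (_∣? n) (suc n) Cyclotomic.Φ ⟨
      evalAt (Cyc.D (suc n) n)
        ≈⟨ evalAt.⟦⟧-cong (Cyc.∏Φ≋Xⁿ-1 0<n) ⟩
      evalAt (xⁿ-1 n)
        ≈⟨ evalAt-xⁿ-1 n ⟩
      (α / β) ^ n - 1# ∎
      where open BigProduct (Cyclotomic.ℤ-ring [X]) commutativeRing evalAt-hom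

  -- Read off from the product formula at n = 1, where 1 is the only divisor, without unfolding
  -- `Φ 1`.
  Ψ1≈α-β : Ψ 1 ≈ α - β
  Ψ1≈α-β = begin
    Ψ 1                                    ≡⟨ when-yes (1 ∣? 1) ∣-refl ⟨
    when (1 ∣? 1) (Ψ 1)                    ≈⟨ big-single (λ d → when (d ∣? 1) (Ψ d)) (s≤s (s≤s z≤n)) other ⟨
    big 2 (λ d → when (d ∣? 1) (Ψ d))      ≈⟨ ∏Ψ≈αⁿ-βⁿ {1} z<s ⟩
    α * 1# - β * 1#                        ≈⟨ +-cong (*-identityʳ α) (-‿cong (*-identityʳ β)) ⟩
    α - β                                  ∎
    where
    other : ∀ d → d < 2 → d ≢ 1 → when (d ∣? 1) (Ψ d) ≈ 1#
    other d d<2 d≢1 = reflexive (when-no (d ∣? 1) λ d∣1 →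
      d≢1 (ℕₚ.≤-antisym (ℕₚ.≤-pred d<2) (∣⇒0< z<s d∣1)))

  -- Factorisation into Lucas atoms

  module _ (Λ : ℕ → P.Carrier) (atoms : IsLucasAtoms L ι α β Λ) where

    -- The bound 2 ≤ d keeps the product within the range where `ι (Λ d)` is prescribed to be `Ψ d`.
    ι-∏Λ : {P : Pred ℕ p} (P? : Decidable P) → (∀ d → P d → 2 ≤ d) → ∀ n →
      ι (∏ F[B,C] (filter P? (upTo n)) Λ) ≈ big n (λ d → when (P? d) (Ψ d))
    ι-∏Λ P? P⇒2≤ n = begin
      ι (∏ F[B,C] (filter P? (upTo n)) Λ)
        ≈⟨ ι.⟦⟧-cong (PolyOps.foldr-filter P? Λ n) ⟩
      ι (PolyOps.big n (λ d → PolyOps.when (P? d) (Λ d)))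
        ≈⟨ big-when-homo P? n Λ ⟩
      big n (λ d → when (P? d) (ι (Λ d)))
        ≈⟨ big-cong n (λ d _ → when-cong (P? d) (λ Pd → proj₂ atoms d (P⇒2≤ d Pd))) ⟩
      big n (λ d → when (P? d) (Ψ d)) ∎
      where open BigProduct F[B,C] commutativeRing ι.isRingHomomorphism

    𝒰-factorisation : ∀ {n} → 0 < n →
      𝒰 n P.≈ ∏ F[B,C] (filter (λ d → (d ∣? n) ×-dec (1 <? d)) (upTo (suc n))) Λ
    𝒰-factorisation {n} 0<n = ι.injective (regular-cancel (≉0⇒regular α-β≉0) (begin
      (α - β) * ι (𝒰 n)
        ≈⟨ *-comm _ _ ⟩
      ι (𝒰 n) * (α - β)
        ≈⟨ ι-𝒰 n ⟩
      α ^ n - β ^ n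
        ≈⟨ ∏Ψ≈αⁿ-βⁿ 0<n ⟨
      big (suc n) (λ d → when (d ∣? n) (Ψ d))
        ≈⟨ big-split (_∣? n) Q? (λ _ → proj₁) (suc n) Ψ ⟩
      big (suc n) (λ d → when (Q? d) (Ψ d)) * big (suc n) rest
        -- Divisors of n are positive, so d = 1 is the only one failing 1 < d, and it contributes α
        -- - β.
        ≈⟨ *-cong (sym (ι-∏Λ Q? (λ _ → proj₂) (suc n))) (trans (big-single rest (s≤s 0<n) other) rest1) ⟩
      ι (∏ F[B,C] (filter Q? (upTo (suc n))) Λ) * (α - β)
        ≈⟨ *-comm _ _ ⟩
      (α - β) * ι (∏ F[B,C] (filter Q? (upTo (suc n))) Λ) ∎))
      where
      Q? : Decidable (λ d → d ∣ n × 1 < d)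
      Q? d = (d ∣? n) ×-dec (1 <? d)

      rest : ℕ → Carrier
      rest d = when ((d ∣? n) ×-dec ¬? (Q? d)) (Ψ d)

      rest1 : rest 1 ≈ α - β
      rest1 = trans
        (reflexive (when-yes ((1 ∣? n) ×-dec ¬? (Q? 1)) (1∣ n , λ (_ , 1<1) → ℕₚ.<-irrefl ≡.refl 1<1)))
        Ψ1≈α-β

      other : ∀ d → d < suc n → d ≢ 1 → rest d ≈ 1#
      other d _ d≢1 = reflexive (when-no ((d ∣? n) ×-dec ¬? (Q? d)) λ (d∣n , ¬Q) →
        ¬Q (d∣n , ℕₚ.≤∧≢⇒< (∣⇒0< 0<n d∣n) (d≢1 ∘ ≡.sym)))

    𝒱-factorisation : ∀ {n} → 0 < n →
      𝒱 n P.≈ ∏ F[B,C] (filter (λ d → (d ∣? (2 ℕ.* n)) ×-dec ¬? (d ∣? n)) (upTo (suc (2 ℕ.* n)))) Λ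
    𝒱-factorisation {n} 0<n = ι.injective (regular-cancel (αⁿ-βⁿ-regular 0<n) (begin
      (α ^ n - β ^ n) * ι (𝒱 n)
        ≈⟨ *-congˡ (ι-𝒱 n) ⟩
      (α ^ n - β ^ n) * (α ^ n + β ^ n)
        ≈⟨ solve 2 (λ x y → (x :- y) :* (x :+ y) := x :* x :- y :* y) refl (α ^ n) (β ^ n) ⟩
      α ^ n * α ^ n - β ^ n * β ^ n
        ≈⟨ +-cong (square α) (-‿cong (square β)) ⟩
      α ^ (2 ℕ.* n) - β ^ (2 ℕ.* n)
        ≈⟨ ∏Ψ≈αⁿ-βⁿ 0<2n ⟨
      big N (λ d → when (d ∣? (2 ℕ.* n)) (Ψ d))
        ≈⟨ big-split (_∣? (2 ℕ.* n)) (_∣? n) (λ _ d∣n → ∣-trans d∣n (n∣m*n 2)) N Ψ ⟩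
      big N (λ d → when (d ∣? n) (Ψ d)) * big N (λ d → when (Q? d) (Ψ d))
        -- The divisors of n are still indexed up to 2 n; those indices beyond n contribute 1, so
        -- the range shrinks to fit the product formula for n.
        ≈⟨ *-cong (trans (big-extend _ (s≤s (ℕₚ.m≤n*m n 2)) beyond) (∏Ψ≈αⁿ-βⁿ 0<n))
                  (sym (ι-∏Λ Q? nontrivial N)) ⟩
      (α ^ n - β ^ n) * ι (∏ F[B,C] (filter Q? (upTo N)) Λ) ∎))
      where
      N = suc (2 ℕ.* n)

      Q? : Decidable (λ d → d ∣ 2 ℕ.* n × d ∤ n)
      Q? d = (d ∣? (2 ℕ.* n)) ×-dec ¬? (d ∣? n)

      0<2n : 0 < 2 ℕ.* n
      0<2n = ℕₚ.<-≤-trans 0<n (ℕₚ.m≤n*m n 2)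

      beyond : ∀ d → suc n ≤ d → when (d ∣? n) (Ψ d) ≈ 1#
      beyond d n<d = reflexive (when-no (d ∣? n) (<⇒∤ 0<n n<d))

      nontrivial : ∀ d → d ∣ 2 ℕ.* n × d ∤ n → 2 ≤ d
      nontrivial d (d∣2n , d∤n) = ℕₚ.≤∧≢⇒< (∣⇒0< 0<2n d∣2n) λ { ≡.refl → d∤n (1∣ n) }

      square : ∀ x → x ^ n * x ^ n ≈ x ^ (2 ℕ.* n)
      square x = trans (sym (^-homo-* x n n))
        -- `2 ℕ.* n` unfolds to n + (n + 0).
        (^-congʳ x (≡.cong (n ℕ.+_) (≡.sym (ℕₚ.+-identityʳ n))))
open import Data.Nat.Base using (_*_; _^_)

theorem3p7 : {c ℓ c′ ℓ′ : Level} (p k : ℕ) → Prime p → 1 ≤ k →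
    (F : Field c ℓ) → HasCardinality F (p ^ k) →
    let open LucasPolynomials F
        open CommutativeRing F[B,C] using (_≈_)
    in
    (L : Field c′ ℓ′) (ι : CommutativeRing.Carrier F[B,C] → Field.Carrier L) →
    IsAlgebraicClosureOfFrac F[B,C] L ι →
    (α β : Field.Carrier L) → AreTheRoots L ι α β →
    (Λ : ℕ → CommutativeRing.Carrier F[B,C]) → IsLucasAtoms L ι α β Λ →
    (n : ℕ) → 1 ≤ n →
      (𝒰 n ≈ ∏ F[B,C] (filter (λ d → (d ∣? n) ×-dec (1 <? d)) (upTo (suc n))) Λ)
      × (𝒱 n ≈ ∏ F[B,C] (filter (λ d → (d ∣? (2 * n)) ×-dec ¬? (d ∣? n)) (upTo (suc (2 * n)))) Λ)
theorem3p7 p k _ _ F _ L ι closure α β roots Λ atoms n 1≤n =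
  𝒰-factorisation Λ atoms 1≤n , 𝒱-factorisation Λ atoms 1≤n
  where
  open LucasFactorisation F L ι (IsAlgebraicClosureOfFrac.isRingMonomorphism closure) α β roots
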